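{- Let $b\in\{5,7,11,13,21,23,27,29\}$. The Diophantine equation $$(2^k-1)(b^k-1)=x^n$$ has no solution in positive integers $(k,x,n)$ with $k\ge 2$ and $n\ge 2$, except for the solution $(2^2-1)(7^2-1)=12^2$, i.e. $b=7$ and $(k,x,n)=(2,12,2)$. -}

module Defs where

{-# OPTIONS --safe #-}
module Submission where

-- It suffices to treat (2^k − 1)(b^k − 1) = y^p with p prime.
--
-- For odd k the left-hand side is even, not divisible by 8, and not a square modulo 480
-- (modulo 1408 for k = 3).
--
-- For k = 2t and p = 2, put A = 2^t, B = b^t and C = AB − y. Then A² + B² + C² = 1 + 2ABC, and Vieta
-- jumping shows that the even numbers A and C have the same 2-adic valuation, so A divides C and
-- 2^k = A² divides B² − 1 = b^k − 1; by lifting the exponent 2^k divides 8k, hence k ≤ 4.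
--
-- For even k and odd p, every m ≤ p divides k, by strong induction on m: let q be a prime factor of
-- m, so m/q and q − 1 divide k. If k had no more factors q than m/q, lifting the exponent at q would
-- make the valuation of the left-hand side positive but less than p. In particular k = sp, and with
-- A = 2^s, B = b^s the equation (A^p − 1)(B^p − 1) = y^p is impossible for reasons of size: since
-- b < 2^5, Padé approximants of (1 − A^(−p))^(1/p) trap an integer strictly between 0 and 1.

open import Defs
open import Data.Nat
open import Data.Nat.Combinatorics using (nCn≡1; nCk+nC[k+1]≡[n+1]C[k+1]; k>n⇒nCk≡0) renaming (_C_ to _choose_)
open import Data.Nat.DivMod using (_%_; _/_; m≡m%n+[m/n]*n; m%n<n; [m+kn]%n≡m%n; %-distribˡ-*)
open import Data.Nat.Divisibility
open import Data.Nat.Induction using (<-rec)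
open import Data.Nat.ListAction using (product)
open import Data.Nat.Primality
open import Data.Nat.Primality.Factorisation using (factorise)
open import Data.Nat.Properties
open import Data.Nat.Tactic.RingSolver using (solve-∀)
open import Data.List using (List; []; _∷_)
open import Data.List.Membership.Propositional using (_∈_)
open import Data.List.Relation.Unary.All as All using (All; []; _∷_)
open import Data.Product using (_×_; _,_; ∃; proj₁; proj₂)
open import Data.Sum using (_⊎_; inj₁; inj₂; [_,_]′)
open import Data.Empty using (⊥; ⊥-elim)
open import Function using (_∘_; it)
open import Function.Bundles using (_⇔_; mk⇔)
open import Relation.Nullary
open import Relation.Nullary.Decidable using (True; toWitness; from-yes; from-no; _×-dec_; _→-dec_; _⊎-dec_; ¬?)
open import Relation.Unary using (Decidable)
open import Relation.Binary.PropositionalEquality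

-- Powers and divisibility by primes

suc-pred-^ : ∀ a k → 1 ≤ a → suc (a ^ k ∸ 1) ≡ a ^ k
suc-pred-^ a k 1≤a = m+[n∸m]≡n (m^n>0 a {{>-nonZero 1≤a}} k)

^-cancel-∣ : ∀ {q u} → Prime q → q ∤ u → ∀ j n → q ^ j ∣ u * n → q ^ j ∣ n
^-cancel-∣ pq q∤u zero n _ = 1∣ n
^-cancel-∣ {q} {u} pq q∤u (suc j) n q^∣un
  with euclidsLemma u n pq (∣-trans (m∣m*n (q ^ j)) q^∣un)
... | inj₁ q∣u = contradiction q∣u q∤u
... | inj₂ (divides-refl n′) =
  subst (q * q ^ j ∣_) (*-comm q n′) (*-monoʳ-∣ q (^-cancel-∣ pq q∤u j n′
    (*-cancelˡ-∣ q {{prime⇒nonZero pq}} (subst (q * q ^ j ∣_) (regroup u n′ q) q^∣un))))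
  where
  regroup : ∀ a b c → a * (b * c) ≡ c * (a * b)
  regroup = solve-∀

-- A pigeonhole on valuations: if `m` supplies at most `i` of the `i + j` factors `q`, the other `j`
-- must come from `n`.
^-split-∣ : ∀ {q} → Prime q → ∀ i j m n →
            q ^ (i + j) ∣ m * n → q ^ suc i ∣ m ⊎ q ^ j ∣ n
^-split-∣ {q} pq i j m n q^∣mn with q ∣? m
... | no q∤m = inj₂ (^-cancel-∣ pq q∤m j n
        (∣-trans (subst (q ^ j ∣_) (sym (^-distribˡ-+-* q i j)) (n∣m*n (q ^ i))) q^∣mn))
^-split-∣ {q} pq zero j m n q^∣mn | yes q∣m = inj₁ (subst (_∣ m) (sym (*-identityʳ q)) q∣m)
^-split-∣ {q} pq (suc i) j .(m * q) n q^∣mn | yes (divides-refl m)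
  with ^-split-∣ pq i j m n
         (*-cancelˡ-∣ q {{prime⇒nonZero pq}} (subst (q * q ^ (i + j) ∣_) (regroup m n q) q^∣mn))
  where
  regroup : ∀ a b c → a * c * b ≡ c * (a * b)
  regroup = solve-∀
... | inj₁ q^∣m = inj₁ (subst (q * q ^ suc i ∣_) (*-comm q m) (*-monoʳ-∣ q q^∣m))
... | inj₂ q^∣n = inj₂ q^∣n

∤-* : ∀ {q m n} → Prime q → q ∤ m → q ∤ n → q ∤ m * n
∤-* {m = m} {n} pq q∤m q∤n q∣mn with euclidsLemma m n pq q∣mn
... | inj₁ q∣m = q∤m q∣m
... | inj₂ q∣n = q∤n q∣n

∣^⇒∣ : ∀ {q} → Prime q → ∀ m n → q ∣ m ^ n → q ∣ m
∣^⇒∣ pq m zero q∣1 = contradiction (∣1⇒≡1 q∣1) (nonTrivial⇒≢1 {{prime⇒nonTrivial pq}})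
∣^⇒∣ pq m (suc n) q∣ with euclidsLemma m (m ^ n) pq q∣
... | inj₁ q∣m = q∣m
... | inj₂ q∣m^n = ∣^⇒∣ pq m n q∣m^n

∣⇒^∣^ : ∀ {q m} n → q ∣ m → q ^ n ∣ m ^ n
∣⇒^∣^ zero q∣m = ∣-refl
∣⇒^∣^ (suc n) q∣m = *-pres-∣ q∣m (∣⇒^∣^ n q∣m)

∤-suc : ∀ {q n} → Prime q → q ∣ n → q ∤ suc n
∤-suc {q} {n} pq q∣n q∣1+n =
  nonTrivial⇒≢1 {{prime⇒nonTrivial pq}}
    (∣1⇒≡1 (∣m+n∣m⇒∣n (subst (q ∣_) (+-comm 1 n) q∣1+n) q∣n))

-- Fermat's little theorem

[k+1]*[n+1]choose[k+1] : ∀ n k → suc k * (suc n choose suc k) ≡ suc n * (n choose k)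
[k+1]*[n+1]choose[k+1] zero zero = refl
[k+1]*[n+1]choose[k+1] zero (suc k)
  rewrite k>n⇒nCk≡0 {1} {suc (suc k)} (s≤s (s≤s z≤n)) | k>n⇒nCk≡0 {0} {suc k} (s≤s z≤n)
  = *-zeroʳ k
[k+1]*[n+1]choose[k+1] (suc n) zero
  rewrite sym (nCk+nC[k+1]≡[n+1]C[k+1] (suc n) 0)
  = begin
      1 * (1 + suc n choose 1)    ≡⟨ *-identityˡ _ ⟩
      1 + suc n choose 1          ≡⟨ cong suc (*-identityˡ _) ⟨
      1 + 1 * (suc n choose 1)    ≡⟨ cong suc ([k+1]*[n+1]choose[k+1] n 0) ⟩
      suc (suc n * 1)             ∎
  where open ≡-Reasoning
[k+1]*[n+1]choose[k+1] (suc n) (suc k) = begin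
  suc (suc k) * (suc (suc n) choose suc (suc k))
    ≡⟨ cong (suc (suc k) *_) (nCk+nC[k+1]≡[n+1]C[k+1] (suc n) (suc k)) ⟨
  suc (suc k) * (x + y)                    ≡⟨ regroup k x y ⟩
  suc k * x + suc (suc k) * y + x
    ≡⟨ cong₂ (λ u v → u + v + x) ([k+1]*[n+1]choose[k+1] n k) ([k+1]*[n+1]choose[k+1] n (suc k)) ⟩
  suc n * (n choose k) + suc n * (n choose suc k) + x
    ≡⟨ cong (_+ x) (*-distribˡ-+ (suc n) (n choose k) (n choose suc k)) ⟨
  suc n * (n choose k + n choose suc k) + x
    ≡⟨ cong (λ u → suc n * u + x) (nCk+nC[k+1]≡[n+1]C[k+1] n k) ⟩
  suc n * x + x                            ≡⟨ +-comm _ x ⟩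
  suc (suc n) * x                          ∎
  where
  open ≡-Reasoning
  x = suc n choose suc k
  y = suc n choose suc (suc k)
  regroup : ∀ k x y → suc (suc k) * (x + y) ≡ suc k * x + suc (suc k) * y + x
  regroup = solve-∀

-- The terms of degree below `m` in the expansion of `suc a ^ n`. Truncation lets `freshman` split
-- off the leading term `a ^ q`; among the terms below it, all but the constant one are multiples of
-- `q`.
binomialSum : ℕ → ℕ → ℕ → ℕ
binomialSum a n zero    = 0
binomialSum a n (suc m) = binomialSum a n m + (n choose m) * a ^ m

binomialSum-suc : ∀ a n m →
  binomialSum a (suc n) (suc m) ≡ binomialSum a n (suc m) + a * binomialSum a n m
binomialSum-suc a n zero = cong suc (sym (*-zeroʳ a))
binomialSum-suc a n (suc m)
  rewrite binomialSum-suc a n m | sym (nCk+nC[k+1]≡[n+1]C[k+1] n m)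
  = regroup a (binomialSum a n m) (n choose m) (a ^ m) (n choose suc m)
  where
  regroup : ∀ a s x p y → s + x * p + a * s + (x + y) * (a * p) ≡
                          s + x * p + y * (a * p) + a * (s + x * p)
  regroup = solve-∀

binomial-theorem : ∀ a n → suc a ^ n ≡ binomialSum a n (suc n)
binomial-theorem a zero = refl
binomial-theorem a (suc n) = begin
  suc a * suc a ^ n                       ≡⟨ cong (suc a *_) (binomial-theorem a n) ⟩
  s + a * s                               ≡⟨ cong (_+ a * s) (+-identityʳ s) ⟨
  s + 0 * a ^ suc n + a * s
    ≡⟨ cong (λ c → s + c * a ^ suc n + a * s) (k>n⇒nCk≡0 (n<1+n n)) ⟨
  binomialSum a n (2 + n) + a * s         ≡⟨ binomialSum-suc a n (suc n) ⟨
  binomialSum a (suc n) (2 + n)           ∎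
  where
  open ≡-Reasoning
  s = binomialSum a n (suc n)

prime∣C : ∀ {q} → Prime q → ∀ k → suc k < q → q ∣ q choose suc k
prime∣C {suc n} pq k k<q
  with euclidsLemma (suc k) (suc n choose suc k) pq
         (subst (suc n ∣_) (sym ([k+1]*[n+1]choose[k+1] n k)) (m∣m*n (n choose k)))
... | inj₁ q∣ = contradiction (∣⇒≤ q∣) (<⇒≱ k<q)
... | inj₂ q∣ = q∣

binomialSum-prime : ∀ {q} → Prime q → ∀ a m → m < q →
                    ∃ λ c → binomialSum a q (suc m) ≡ 1 + q * c
binomialSum-prime {q} pq a zero _ = 0 , cong suc (sym (*-zeroʳ q))
binomialSum-prime {q} pq a (suc m) m<q
  with binomialSum-prime pq a m (<-trans (n<1+n m) m<q) | prime∣C pq m m<q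
... | c , eq | divides d eq′ rewrite eq | eq′ = c + d * a ^ suc m , regroup q c d (a ^ suc m)
  where
  regroup : ∀ q c d x → 1 + q * c + d * q * x ≡ 1 + q * (c + d * x)
  regroup = solve-∀

freshman : ∀ {q} → Prime q → ∀ a → ∃ λ c → suc a ^ q ≡ suc (a ^ q) + q * c
freshman {suc n} pq a with binomialSum-prime pq a n (n<1+n n)
... | c , eq = c , (begin
  suc a ^ suc n                                 ≡⟨ binomial-theorem a (suc n) ⟩
  binomialSum a (suc n) (suc n) + (suc n choose suc n) * a ^ suc n
    ≡⟨ cong₂ (λ u v → u + v * a ^ suc n) eq (nCn≡1 (suc n)) ⟩
  1 + suc n * c + 1 * a ^ suc n                 ≡⟨ regroup (suc n) c (a ^ suc n) ⟩
  suc (a ^ suc n) + suc n * c                   ∎)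
  where
  open ≡-Reasoning
  regroup : ∀ q c x → 1 + q * c + 1 * x ≡ suc x + q * c
  regroup = solve-∀

fermat : ∀ {q} → Prime q → ∀ a → ∃ λ c → a ^ q ≡ a + q * c
fermat {suc n} pq zero = 0 , sym (*-zeroʳ n)
fermat {q} pq (suc a) with fermat pq a | freshman pq a
... | c , eq | d , eq′ = c + d , (begin
  suc a ^ q                  ≡⟨ eq′ ⟩
  suc (a ^ q) + q * d        ≡⟨ cong (λ u → suc u + q * d) eq ⟩
  suc (a + q * c) + q * d    ≡⟨ regroup a q c d ⟩
  suc a + q * (c + d)        ∎)
  where
  open ≡-Reasoning
  regroup : ∀ a q c d → suc (a + q * c) + q * d ≡ suc a + q * (c + d)
  regroup = solve-∀

∣a^[q-1]∸1 : ∀ {n} → Prime (suc n) → ∀ a → suc n ∤ a → suc n ∣ a ^ n ∸ 1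
∣a^[q-1]∸1 {n} pq zero q∤0 = contradiction (suc n ∣0) q∤0
∣a^[q-1]∸1 {n} pq a@(suc _) q∤a with fermat pq a
... | c , eq with euclidsLemma a (a ^ n ∸ 1) pq (divides c (+-cancelˡ-≡ a _ _ (begin
  a + a * (a ^ n ∸ 1)    ≡⟨ *-suc a (a ^ n ∸ 1) ⟨
  a * suc (a ^ n ∸ 1)    ≡⟨ cong (a *_) (suc-pred-^ a n (s≤s z≤n)) ⟩
  a ^ suc n              ≡⟨ eq ⟩
  a + suc n * c          ≡⟨ cong (a +_) (*-comm (suc n) c) ⟩
  a + c * suc n          ∎)))
  where open ≡-Reasoning
... | inj₁ q∣a = contradiction q∣a q∤a
... | inj₂ q∣ = q∣

-- Lifting the exponent

-- The geometric sum in `suc d`, that is the quotient of `suc d ^ m - 1` by `d`. Writing the base as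
-- a successor avoids subtraction.
geo : ℕ → ℕ → ℕ
geo d zero    = 0
geo d (suc m) = 1 + suc d * geo d m

-- The second-order term: the quotient of `geo d m - m` by `d`, as `geo-expand` shows.
geoRem : ℕ → ℕ → ℕ
geoRem d zero    = 0
geoRem d (suc m) = geoRem d m + geo d m

^-geo : ∀ d m → suc d ^ m ≡ suc (d * geo d m)
^-geo d zero = cong suc (sym (*-zeroʳ d))
^-geo d (suc m) rewrite ^-geo d m = regroup d (geo d m)
  where
  regroup : ∀ d g → suc d * suc (d * g) ≡ suc (d * (1 + suc d * g))
  regroup = solve-∀

geo-expand : ∀ d m → geo d m ≡ m + d * geoRem d m
geo-expand d zero = sym (*-zeroʳ d)
geo-expand d (suc m) = begin
  1 + (geo d m + d * geo d m)                ≡⟨ cong (λ u → 1 + (u + d * geo d m)) (geo-expand d m) ⟩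
  1 + (m + d * geoRem d m + d * geo d m)     ≡⟨ regroup m d (geoRem d m) (geo d m) ⟩
  suc m + d * (geoRem d m + geo d m)         ∎
  where
  open ≡-Reasoning
  regroup : ∀ m d r g → 1 + (m + d * r + d * g) ≡ suc m + d * (r + g)
  regroup = solve-∀

-- Since `geo d i` is `i` modulo `d`, the sum `geoRem d m` is the triangular number `m (m - 1) / 2`
-- modulo `d`; doubling avoids the division. For an odd prime `q` dividing `d` this makes
-- `geoRem d q` a multiple of `q`.
geoRem-expand : ∀ d m → ∃ λ v → 2 * geoRem d m + m ≡ m * m + d * v
geoRem-expand d zero = 0 , sym (*-zeroʳ d)
geoRem-expand d (suc m) with geoRem-expand d m
... | v , eq = v + 2 * r , (begin
  2 * (r + geo d m) + suc m           ≡⟨ cong (λ u → 2 * (r + u) + suc m) (geo-expand d m) ⟩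
  2 * (r + (m + d * r)) + suc m       ≡⟨ regroup r m d ⟩
  2 * r + m + (2 * m + 1 + 2 * d * r) ≡⟨ cong (_+ (2 * m + 1 + 2 * d * r)) eq ⟩
  m * m + d * v + (2 * m + 1 + 2 * d * r) ≡⟨ regroup′ m d v r ⟩
  suc m * suc m + d * (v + 2 * r)     ∎)
  where
  open ≡-Reasoning
  r = geoRem d m
  regroup : ∀ r m d → 2 * (r + (m + d * r)) + suc m ≡ 2 * r + m + (2 * m + 1 + 2 * d * r)
  regroup = solve-∀
  regroup′ : ∀ m d v r → m * m + d * v + (2 * m + 1 + 2 * d * r) ≡ suc m * suc m + d * (v + 2 * r)
  regroup′ = solve-∀

-- For d divisible by f, raising 1 + d to the power q gains exactly one factor q.
Liftable : ℕ → ℕ → Set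
Liftable q f = ∀ d → f ∣ d → q ∣ d × q * q ∣ d * geoRem d q

liftable-odd : ∀ {q} → Prime q → 3 ≤ q → Liftable q q
liftable-odd {q} pq 3≤q d q∣d = q∣d , *-pres-∣ q∣d q∣rem
  where
  q∣2rem : q ∣ 2 * geoRem d q
  q∣2rem with geoRem-expand d q
  ... | v , eq = ∣m+n∣m⇒∣n
          (subst (q ∣_) (trans (sym eq) (+-comm (2 * geoRem d q) q))
            (∣m∣n⇒∣m+n (m∣m*n q) (∣m⇒∣m*n v q∣d)))
          ∣-refl
  q∣rem : q ∣ geoRem d q
  q∣rem with euclidsLemma 2 (geoRem d q) pq q∣2rem
  ... | inj₁ q∣2 = contradiction (∣⇒≤ q∣2) (<⇒≱ 3≤q)
  ... | inj₂ r = r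

-- `geoRem d 2` equals 1, so both factors 2 have to come from `d`; hence the 4.
liftable-two : Liftable 2 4
liftable-two d 4∣d =
  ∣-trans (divides-refl 2) 4∣d , ∣m⇒∣m*n (geoRem d 2) 4∣d

geo-prime : ∀ {q f d} → Prime q → Liftable q f → f ∣ d →
            ∃ λ u → q ∤ u × geo d q ≡ q * u
geo-prime {q} {f} {d} pq lift f∣d with lift d f∣d
... | q∣d , divides v eq = suc (v * q) , ∤-suc pq (n∣m*n v) , (begin
  geo d q               ≡⟨ geo-expand d q ⟩
  q + d * geoRem d q    ≡⟨ cong (q +_) eq ⟩
  q + v * (q * q)       ≡⟨ regroup q v ⟩
  q * suc (v * q)       ∎)
  where
  open ≡-Reasoning
  regroup : ∀ q v → q + v * (q * q) ≡ q * suc (v * q)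
  regroup = solve-∀

-- A valuation-free form of the upper bound in lifting the exponent: up to a factor `u` prime to
-- `q`, `suc d ^ m - 1` divides `d * m`. The induction strips factors `q` from `m`: raising
-- `suc e = suc d ^ i` to the power `q` multiplies `e` by `geo e q`, which `geo-prime` shows to be
-- `q` times a number prime to `q`.
geo-lift : ∀ {q f d} → Prime q → Liftable q f → f ∣ d → ∀ m → 1 ≤ m →
           ∃ λ u → q ∤ u × d * geo d m ∣ d * m * u
geo-lift {q} {f} {d} pq lift f∣d = <-rec _ step
  where
  step : ∀ m → (∀ {i} → i < m → 1 ≤ i → ∃ λ u → q ∤ u × d * geo d i ∣ d * i * u) →
         1 ≤ m → ∃ λ u → q ∤ u × d * geo d m ∣ d * m * u
  step m rec 1≤m with q ∣? m
  -- `geo d m` is `m` modulo `q`, so it is itself prime to `q` and serves as `u`.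
  ... | no q∤m = geo d m , q∤geo , divides m (regroup d m (geo d m))
    where
    regroup : ∀ d m g → d * m * g ≡ m * (d * g)
    regroup = solve-∀
    q∤geo : q ∤ geo d m
    q∤geo q∣geo = q∤m (∣m+n∣m⇒∣n
      (subst (q ∣_) (trans (geo-expand d m) (+-comm m _)) q∣geo)
      (∣m⇒∣m*n (geoRem d m) (proj₁ (lift d f∣d))))
  ... | yes (divides-refl i)
      with rec {i} (m<m*n i q {{>-nonZero 1≤i}} (nonTrivial⇒n>1 q {{prime⇒nonTrivial pq}})) 1≤i
         | geo-prime {d = d * geo d i} pq lift (∣m⇒∣m*n (geo d i) f∣d)
    where
    1≤i : 1 ≤ i
    1≤i = >-nonZero⁻¹ i {{m*n≢0⇒m≢0 i {{>-nonZero 1≤m}}}}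
  ... | u , q∤u , div | v , q∤v , eq = u * v , ∤-* pq q∤u q∤v ,
    subst₂ _∣_ lhs (regroup d i u q v) (*-monoˡ-∣ (q * v) div)
    where
    open ≡-Reasoning
    e = d * geo d i
    regroup : ∀ d i u q v → d * i * u * (q * v) ≡ d * (i * q) * (u * v)
    regroup = solve-∀
    lhs : e * (q * v) ≡ d * geo d (i * q)
    lhs = suc-injective (begin
      suc (e * (q * v))             ≡⟨ cong (λ g → suc (e * g)) eq ⟨
      suc (e * geo e q)             ≡⟨ ^-geo e q ⟨
      suc e ^ q                     ≡⟨ cong (_^ q) (^-geo d i) ⟨
      (suc d ^ i) ^ q               ≡⟨ ^-*-assoc (suc d) i q ⟩
      suc d ^ (i * q)               ≡⟨ ^-geo d (i * q) ⟩
      suc (d * geo d (i * q))       ∎)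

^∸1-geo : ∀ a r g → 1 ≤ a → a ^ (r * g) ∸ 1 ≡ (a ^ r ∸ 1) * geo (a ^ r ∸ 1) g
^∸1-geo a r g 1≤a = cong (_∸ 1) (begin
  a ^ (r * g)                                ≡⟨ ^-*-assoc a r g ⟨
  (a ^ r) ^ g                                ≡⟨ cong (_^ g) (suc-pred-^ a r 1≤a) ⟨
  suc (a ^ r ∸ 1) ^ g                        ≡⟨ ^-geo (a ^ r ∸ 1) g ⟩
  suc ((a ^ r ∸ 1) * geo (a ^ r ∸ 1) g)      ∎)
  where open ≡-Reasoning

^∸1-∣ : ∀ a r g → 1 ≤ a → a ^ r ∸ 1 ∣ a ^ (r * g) ∸ 1
^∸1-∣ a r g 1≤a = subst (a ^ r ∸ 1 ∣_) (sym (^∸1-geo a r g 1≤a)) (m∣m*n _)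

lifting-the-exponent : ∀ {q f} → Prime q → Liftable q f → ∀ a r g →
  1 ≤ a → f ∣ a ^ r ∸ 1 → 1 ≤ g →
  ∃ λ u → q ∤ u × a ^ (r * g) ∸ 1 ∣ (a ^ r ∸ 1) * g * u
lifting-the-exponent pq lift a r g 1≤a f∣ 1≤g with geo-lift pq lift f∣ g 1≤g
... | u , q∤u , div = u , q∤u , subst (_∣ (a ^ r ∸ 1) * g * u) (sym (^∸1-geo a r g 1≤a)) div

lifting-fermat : ∀ {n} → Prime (suc n) → 2 ≤ n → ∀ a g → 1 ≤ a → 1 ≤ g →
  ∃ λ u → suc n ∤ u × a ^ (n * g) ∸ 1 ∣ (a ^ n ∸ 1) * g * u
lifting-fermat {n} pq 2≤n a g 1≤a 1≤g with suc n ∣? a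
... | no q∤a = lifting-the-exponent pq (liftable-odd pq (s≤s 2≤n)) a n g 1≤a (∣a^[q-1]∸1 pq a q∤a) 1≤g
-- Here `a ^ (n * g) ∸ 1` is itself prime to `q` and serves as `u`, so bases divisible by `q` need
-- no separate treatment later.
... | yes q∣a = a ^ (n * g) ∸ 1 , q∤u , n∣m*n ((a ^ n ∸ 1) * g)
  where
  1≤ng : 1 ≤ n * g
  1≤ng = *-mono-≤ (≤-trans (s≤s z≤n) 2≤n) 1≤g
  q∣a^ : suc n ∣ a ^ (n * g)
  q∣a^ with n * g | 1≤ng
  ... | suc e | _ = ∣m⇒∣m*n (a ^ e) q∣a
  q∤u : suc n ∤ a ^ (n * g) ∸ 1
  q∤u q∣u = ∤-suc pq q∣u (subst (suc n ∣_) (sym (suc-pred-^ a (n * g) 1≤a)) q∣a^)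

-- The bases and their finite checks

bases : List ℕ
bases = 5 ∷ 7 ∷ 11 ∷ 13 ∷ 21 ∷ 23 ∷ 27 ∷ 29 ∷ []

powerProduct : ℕ → ℕ → ℕ
powerProduct b k = (2 ^ k ∸ 1) * (b ^ k ∸ 1)

-- Opaque, so that with-abstractions do not unfold the decision procedures.
opaque
  on-bases : ∀ {P : ℕ → Set} (P? : Decidable P) {_ : True (All.all? P? bases)} →
             ∀ {b} → b ∈ bases → P b
  on-bases P? {t} = All.lookup (toWitness t)

base-bounds : ∀ {b} → b ∈ bases → 5 ≤ b × b ≤ 29
base-bounds = on-bases (λ b → 5 ≤? b ×-dec b ≤? 29)

1≤base : ∀ {b} → b ∈ bases → 1 ≤ b
1≤base b∈ = ≤-trans (s≤s z≤n) (proj₁ (base-bounds b∈))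

4∣base²∸1 : ∀ {b} → b ∈ bases → 4 ∣ b ^ 2 ∸ 1
4∣base²∸1 = on-bases (λ b → 4 ∣? b ^ 2 ∸ 1)

-- 240240 = 2⁴ · 3 · 5 · 7 · 11 · 13 is a common multiple of the numbers b² − 1.
base²∸1∣16*odd : ∀ {b} → b ∈ bases → ∃ λ c → 2 ∤ c × b ^ 2 ∸ 1 ∣ 16 * c
base²∸1∣16*odd b∈ =
  15015 , from-no (2 ∣? 15015) , on-bases (λ b → (b ^ 2 ∸ 1) ∣? 16 * 15015) b∈

-- Gives powers of `b` the period 8 modulo 480 = 2^5 · 3 · 5 from exponent 5 on. The same holds for
-- powers of 2, where `2 ^ 5` absorbs the 2-part of 480.
480∣b^13∸b^5 : ∀ {b} → b ∈ bases → 480 ∣ b ^ 5 * (b ^ 8 ∸ 1)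
480∣b^13∸b^5 = on-bases (λ b → 480 ∣? b ^ 5 * (b ^ 8 ∸ 1))

-- The bound 57 is where size takes over in `self-power-∤`: from there on `suc n` is at least 58,
-- twice the largest base.
self-power-∤-small : ∀ {b} → b ∈ bases → ∀ {n} → n < 57 → 2 ≤ n → suc n ^ suc n ∤ powerProduct b n
self-power-∤-small = on-bases (λ b → allUpTo? (λ n → 2 ≤? n →-dec ¬? (suc n ^ suc n ∣? powerProduct b n)) 57)

NonSquare : ∀ m → .{{NonZero m}} → ℕ → Set
NonSquare m r = ∀ {y} → y < m → (y * y) % m ≢ r

nonSquare? : ∀ m → .{{_ : NonZero m}} → ∀ r → Dec (NonSquare m r)
nonSquare? m r = allUpTo? (λ y → ¬? ((y * y) % m ≟ r)) m

nonSquare : ∀ {m N} → .{{_ : NonZero m}} → NonSquare m (N % m) → ∀ y → N ≢ y * y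
nonSquare {m} nsq y refl = nsq (m%n<n y m) (sym (%-distribˡ-* y y m))

-- The single modulus 1408 = 2^7 · 11 settles the exponents 2, 3 and 4 for all bases; the exception
-- is the true square 144.
small-exponents : ∀ {b} → b ∈ bases → ∀ {i} → i < 3 →
                  NonSquare 1408 (powerProduct b (2 + i) % 1408) ⊎ b ≡ 7 × i ≡ 0
small-exponents = on-bases (λ b → allUpTo? (λ i →
  nonSquare? 1408 (powerProduct b (2 + i) % 1408) ⊎-dec (b ≟ 7 ×-dec i ≟ 0)) 3)

-- Growth bounds and 2-adic valuations

*-^-distrib : ∀ a b n → (a * b) ^ n ≡ a ^ n * b ^ n
*-^-distrib a b zero = refl
*-^-distrib a b (suc n) = begin
  a * b * (a * b) ^ n        ≡⟨ cong (a * b *_) (*-^-distrib a b n) ⟩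
  a * b * (a ^ n * b ^ n)    ≡⟨ [m*n]*[o*p]≡[m*o]*[n*p] a b (a ^ n) (b ^ n) ⟩
  a * a ^ n * (b * b ^ n)    ∎
  where open ≡-Reasoning

pred-^>0 : ∀ {a n} → 2 ≤ a → 1 ≤ n → 1 ≤ a ^ n ∸ 1
pred-^>0 {a} {suc n} 2≤a _ = ∸-monoˡ-≤ 1 (*-mono-≤ 2≤a (m^n>0 a {{>-nonZero (≤-trans (s≤s z≤n) 2≤a)}} n))

-- For a prime `q = suc n` this keeps the `q`-adic valuation of `powerProduct b n`, the starting
-- value for lifting the exponent, below `q`.
self-power-∤ : ∀ {b} → b ∈ bases → ∀ n → 2 ≤ n → suc n ^ suc n ∤ powerProduct b n
self-power-∤ {b} b∈ n 2≤n with n <? 57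
... | yes n<57 = self-power-∤-small b∈ n<57 2≤n
... | no n≮57 = >⇒∤ {{>-nonZero (*-mono-≤ (pred-^>0 {2} ≤-refl 1≤n) (pred-^>0 2≤b 1≤n))}} (begin-strict
  powerProduct b n       ≤⟨ *-mono-≤ (m∸n≤m (2 ^ n) 1) (m∸n≤m (b ^ n) 1) ⟩
  2 ^ n * b ^ n          ≡⟨ *-^-distrib 2 b n ⟨
  (2 * b) ^ n            ≤⟨ ^-monoˡ-≤ n (*-monoʳ-≤ 2 (proj₂ (base-bounds b∈))) ⟩
  58 ^ n                 ≤⟨ ^-monoˡ-≤ n (s≤s (≮⇒≥ n≮57)) ⟩
  suc n ^ n              <⟨ ^-monoʳ-< (suc n) (s≤s 1≤n) (n<1+n n) ⟩
  suc n ^ suc n          ∎)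
  where
  open ≤-Reasoning
  1≤n : 1 ≤ n
  1≤n = ≤-trans (s≤s z≤n) 2≤n
  2≤b : 2 ≤ b
  2≤b = ≤-trans (s≤s (s≤s z≤n)) (proj₁ (base-bounds b∈))

-- Applied with `q + d = p` to refute `q ^ suc d ∣ m * m` when `m * q ≤ p`. When `d` grows by one,
-- the left side at most triples, while the right side gains a factor `q`, at least 3.
^-exceeds-square : ∀ {q} → 3 ≤ q → ∀ d → (q + d) * (q + d) < q * q * q ^ suc d
^-exceeds-square {q} 3≤q zero rewrite +-identityʳ q | *-identityʳ q =
  m<m*n (q * q) q {{>-nonZero (*-mono-≤ 1≤q 1≤q)}} (≤-trans (s≤s (s≤s z≤n)) 3≤q)
  where
  1≤q : 1 ≤ q
  1≤q = ≤-trans (s≤s z≤n) 3≤q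
^-exceeds-square {q} 3≤q (suc d) = begin-strict
  (q + suc d) * (q + suc d)      ≡⟨ cong (λ u → u * u) (+-suc q d) ⟩
  suc x * suc x                  ≡⟨ expand x ⟩
  x * x + 2 * x + 1              ≤⟨ +-mono-≤ (+-monoʳ-≤ (x * x) (*-monoˡ-≤ x 2≤x)) (*-mono-≤ 1≤x 1≤x) ⟩
  x * x + x * x + x * x          ≡⟨ triple x ⟩
  3 * (x * x)                    ≤⟨ *-monoˡ-≤ (x * x) 3≤q ⟩
  q * (x * x)                    <⟨ *-monoʳ-< q {{>-nonZero 1≤q}} (^-exceeds-square 3≤q d) ⟩
  q * (q * q * q ^ suc d)        ≡⟨ regroup q (q ^ suc d) ⟩
  q * q * (q * q ^ suc d)        ∎
  where
  open ≤-Reasoning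
  x = q + d
  1≤q : 1 ≤ q
  1≤q = ≤-trans (s≤s z≤n) 3≤q
  2≤x : 2 ≤ x
  2≤x = ≤-trans (s≤s (s≤s z≤n)) (≤-trans 3≤q (m≤m+n q d))
  1≤x : 1 ≤ x
  1≤x = ≤-trans (s≤s z≤n) 2≤x
  expand : ∀ x → suc x * suc x ≡ x * x + 2 * x + 1
  expand = solve-∀
  triple : ∀ x → x * x + x * x + x * x ≡ 3 * (x * x)
  triple = solve-∀
  regroup : ∀ q y → q * (q * q * y) ≡ q * q * (q * y)
  regroup = solve-∀

∣-square : ∀ {g k} → g ∣ k → g * g ∣ k * k
∣-square g∣k = *-pres-∣ g∣k g∣k

4*n<2^n : ∀ n → 5 ≤ n → 4 * n < 2 ^ n
4*n<2^n n 5≤n with m≤n⇒∃[o]m+o≡n 5≤n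
... | d , refl = go d
  where
  open ≤-Reasoning
  go : ∀ d → 4 * (5 + d) < 2 ^ (5 + d)
  go zero = from-yes (20 <? 32)
  go (suc d) = begin-strict
    4 * (5 + suc d)        ≤⟨ m≤m+n _ (16 + 4 * d) ⟩
    4 * (5 + suc d) + (16 + 4 * d) ≡⟨ regroup d ⟩
    2 * (4 * (5 + d))      <⟨ *-monoʳ-< 2 (go d) ⟩
    2 * 2 ^ (5 + d)        ≡⟨⟩
    2 ^ (5 + suc d)        ∎
    where
    regroup : ∀ d → 4 * (5 + suc d) + (16 + 4 * d) ≡ 2 * (4 * (5 + d))
    regroup = solve-∀

-- Lifting starts from `b ^ 2`, because 4 need not divide `b - 1`; for every base, `b ^ 2 - 1`
-- contains at most four factors 2.
2^∣base^[2t]∸1 : ∀ {b} → b ∈ bases → ∀ j t → 1 ≤ t → 2 ^ j ∣ b ^ (2 * t) ∸ 1 → 2 ^ j ∣ 16 * t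
2^∣base^[2t]∸1 {b} b∈ j t 1≤t 2^j∣
  with base²∸1∣16*odd b∈
     | lifting-the-exponent prime[2] liftable-two b 2 t
         (1≤base b∈) (4∣base²∸1 b∈) 1≤t
... | c , 2∤c , base∣ | u , 2∤u , div = ^-cancel-∣ prime[2] (∤-* prime[2] 2∤c 2∤u) j (16 * t)
  (subst (2 ^ j ∣_) (regroup t u c)
    (∣-trans 2^j∣ (∣-trans div (*-monoˡ-∣ u (*-monoˡ-∣ t base∣)))))
  where
  regroup : ∀ t u c → 16 * c * t * u ≡ c * u * (16 * t)
  regroup = solve-∀

2∤2^k∸1 : ∀ k → 1 ≤ k → 2 ∤ 2 ^ k ∸ 1
2∤2^k∸1 (suc k) _ 2∣ =
  ∤-suc prime[2] 2∣ (subst (2 ∣_) (sym (suc-pred-^ 2 (suc k) (s≤s z≤n))) (m∣m*n (2 ^ k)))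

prime-factor : ∀ n → 2 ≤ n → ∃ λ q → Prime q × q ∣ n
prime-factor n 2≤n with factorise n {{>-nonZero (≤-trans (s≤s z≤n) 2≤n)}}
... | record { factors = [] ; isFactorisation = refl } = contradiction 2≤n λ { (s≤s ()) }
... | record { factors = q ∷ qs ; isFactorisation = refl ; factorsPrime = pq ∷ _ } =
  q , pq , m∣m*n (product qs)

-- Divisors of the exponent

module Exponent {b k y p : ℕ} (b∈ : b ∈ bases) (pp : Prime p) (3≤p : 3 ≤ p)
                (1≤k : 1 ≤ k) (2∣k : 2 ∣ k) (eq : powerProduct b k ≡ y ^ p) where

  1≤b : 1 ≤ b
  1≤b = 1≤base b∈

  prime-power-∣ : ∀ {q} → Prime q → q ∣ powerProduct b k → q ^ p ∣ powerProduct b k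
  prime-power-∣ {q} pq q∣ =
    subst (q ^ p ∣_) (sym eq) (∣⇒^∣^ p (∣^⇒∣ pq y p (subst (q ∣_) eq q∣)))

  -- If `h` were odd, `2 ^ p`, which divides `8 * k`, would divide `8 * m`, which is at most
  -- `4 * p`. This leaves `p = 3` and `m = 1`, but then `h` is the even number `k`.
  cofactor-two : ∀ m h → k ≡ m * h → m * 2 ≤ p → 2 ∣ h
  cofactor-two m h k≡mh 2m≤p with 2 ∣? h
  ... | yes 2∣h = 2∣h
  ... | no 2∤h = ⊥-elim impossible
    where
    t : ℕ
    t = quotient 2∣k
    k≡t2 : k ≡ t * 2
    k≡t2 = m∣n⇒n≡quotient*m 2∣k
    1≤t : 1 ≤ t
    1≤t = >-nonZero⁻¹ t {{m*n≢0⇒m≢0 t {{>-nonZero (subst (1 ≤_) k≡t2 1≤k)}}}}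
    1≤m : 1 ≤ m
    1≤m = >-nonZero⁻¹ m {{m*n≢0⇒m≢0 m {{>-nonZero (subst (1 ≤_) k≡mh 1≤k)}}}}
    k≡2t : k ≡ 2 * t
    k≡2t = trans k≡t2 (*-comm t 2)
    2∣lhs : 2 ∣ powerProduct b k
    2∣lhs = ∣n⇒∣m*n (2 ^ k ∸ 1) (subst (λ e → 2 ∣ b ^ e ∸ 1) (sym k≡2t)
      (∣-trans (∣-trans (divides-refl 2) (4∣base²∸1 b∈)) (^∸1-∣ b 2 t 1≤b)))
    2^p∣16t : 2 ^ p ∣ 16 * t
    2^p∣16t = 2^∣base^[2t]∸1 b∈ p t 1≤t (subst (λ e → 2 ^ p ∣ b ^ e ∸ 1) k≡2t
      (^-cancel-∣ prime[2] (2∤2^k∸1 k 1≤k) p (b ^ k ∸ 1) (prime-power-∣ prime[2] 2∣lhs)))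
    16t≡h*8m : 16 * t ≡ h * (8 * m)
    16t≡h*8m = begin
      16 * t           ≡⟨ *-assoc 8 2 t ⟩
      8 * (2 * t)      ≡⟨ cong (8 *_) (trans (sym k≡2t) k≡mh) ⟩
      8 * (m * h)      ≡⟨ regroup m h ⟩
      h * (8 * m)      ∎
      where
      open ≡-Reasoning
      regroup : ∀ m h → 8 * (m * h) ≡ h * (8 * m)
      regroup = solve-∀
    2^p≤4p : 2 ^ p ≤ 4 * p
    2^p≤4p = begin
      2 ^ p         ≤⟨ ∣⇒≤ {{m*n≢0 8 m {{it}} {{>-nonZero 1≤m}}}}
                         (^-cancel-∣ prime[2] 2∤h p (8 * m) (subst (2 ^ p ∣_) 16t≡h*8m 2^p∣16t)) ⟩
      8 * m         ≡⟨ regroup m ⟩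
      4 * (m * 2)   ≤⟨ *-monoʳ-≤ 4 2m≤p ⟩
      4 * p         ∎
      where
      open ≤-Reasoning
      regroup : ∀ m → 8 * m ≡ 4 * (m * 2)
      regroup = solve-∀
    impossible : ⊥
    impossible = 2∤h (subst (2 ∣_) (trans k≡mh (trans (cong (_* h) m≡1) (*-identityˡ h))) 2∣k)
      where
      p<5 : p < 5
      p<5 = ≰⇒> λ 5≤p → <⇒≱ (4*n<2^n p 5≤p) 2^p≤4p
      p≢4 : p ≢ 4
      p≢4 p≡4 = composite⇒¬prime composite[4] (subst Prime p≡4 pp)
      m≡1 : m ≡ 1
      m≡1 = ≤-antisym (s≤s⁻¹ (*-cancelʳ-< 2 m 2
              (≤-<-trans 2m≤p (≤∧≢⇒< (s≤s⁻¹ p<5) p≢4)))) 1≤m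

  -- Let `q = suc n`. As `n` divides `k`, Fermat makes `q` divide the left-hand side, so `q ^ p`
  -- divides it too. Lifting moves `q ^ p` into `powerProduct b n * (g * g)`; since `g` divides
  -- `k = m * h`, also into `powerProduct b n * (m * m) * (h * h)`. If `q` did not divide `h`, then
  -- splitting `p = n + suc d` would give `q ^ q` dividing `powerProduct b n` or `q ^ suc d`
  -- dividing `m * m`.
  cofactor-odd : ∀ n → Prime (suc n) → 2 ≤ n → n ∣ k →
                 ∀ m h → k ≡ m * h → m * suc n ≤ p → suc n ∣ h
  cofactor-odd n pq 2≤n (divides g k≡gn) m h k≡mh mq≤p with suc n ∣? h
  ... | yes q∣h = q∣h
  ... | no q∤h = ⊥-elim impossible
    where
    q = suc n
    k≡ng : k ≡ n * g
    k≡ng = trans k≡gn (*-comm g n)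
    1≤g : 1 ≤ g
    1≤g = >-nonZero⁻¹ g {{m*n≢0⇒m≢0 g {{>-nonZero (subst (1 ≤_) k≡gn 1≤k)}}}}
    1≤m : 1 ≤ m
    1≤m = >-nonZero⁻¹ m {{m*n≢0⇒m≢0 m {{>-nonZero (subst (1 ≤_) k≡mh 1≤k)}}}}
    q∤2 : q ∤ 2
    q∤2 q∣2 = contradiction (∣⇒≤ q∣2) (<⇒≱ (s≤s 2≤n))
    q∣lhs : q ∣ powerProduct b k
    q∣lhs = ∣m⇒∣m*n (b ^ k ∸ 1) (subst (λ e → q ∣ 2 ^ e ∸ 1) (sym k≡ng)
      (∣-trans (∣a^[q-1]∸1 pq 2 q∤2) (^∸1-∣ 2 n g (s≤s z≤n))))
    q^p∣ : q ^ p ∣ powerProduct b n * (m * m)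
    q^p∣ with lifting-fermat pq 2≤n 2 g (s≤s z≤n) 1≤g | lifting-fermat pq 2≤n b g 1≤b 1≤g
    ... | u , q∤u , div | u′ , q∤u′ , div′ =
      ^-cancel-∣ pq (∤-* pq q∤h q∤h) p _
        (subst (q ^ p ∣_) (trans (cong (λ e → powerProduct b n * (e * e)) k≡mh) (swap-h (powerProduct b n) m h))
          (∣-trans
            (^-cancel-∣ pq (∤-* pq q∤u q∤u′) p _
              (subst (q ^ p ∣_) (swap-u (2 ^ n ∸ 1) (b ^ n ∸ 1) g u u′)
                (∣-trans (prime-power-∣ pq q∣lhs)
                  (subst (λ e → powerProduct b e ∣ _) (sym k≡ng) (*-pres-∣ div div′)))))
            (*-monoʳ-∣ (powerProduct b n) (∣-square (divides n k≡ng)))))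
      where
      swap-u : ∀ x x′ g u u′ → x * g * u * (x′ * g * u′) ≡ u * u′ * (x * x′ * (g * g))
      swap-u = solve-∀
      swap-h : ∀ x m h → x * (m * h * (m * h)) ≡ h * h * (x * (m * m))
      swap-h = solve-∀
    d : ℕ
    d = p ∸ q
    p≡ : q + d ≡ p
    p≡ = m+[n∸m]≡n (≤-trans (m≤n*m q m {{>-nonZero 1≤m}}) mq≤p)
    q^[1+d]∤m² : q ^ suc d ∤ m * m
    q^[1+d]∤m² q^d∣ = <⇒≱ (^-exceeds-square (s≤s 2≤n) d) (begin
      q * q * q ^ suc d          ≤⟨ *-monoʳ-≤ (q * q) (∣⇒≤ {{>-nonZero (*-mono-≤ 1≤m 1≤m)}} q^d∣) ⟩
      q * q * (m * m)            ≡⟨ regroup q m ⟩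
      m * q * (m * q)            ≤⟨ *-mono-≤ mq≤p mq≤p ⟩
      p * p                      ≡⟨ cong (λ e → e * e) p≡ ⟨
      (q + d) * (q + d)          ∎)
      where
      open ≤-Reasoning
      regroup : ∀ q m → q * q * (m * m) ≡ m * q * (m * q)
      regroup = solve-∀
    impossible : ⊥
    impossible = [ self-power-∤ b∈ n 2≤n , q^[1+d]∤m² ]′
      (^-split-∣ pq n (suc d) (powerProduct b n) (m * m)
        (subst (λ e → q ^ e ∣ powerProduct b n * (m * m)) (trans (sym p≡) (sym (+-suc n d))) q^p∣))

  cofactor : ∀ n → Prime (suc n) → (2 ≤ n → n ∣ k) →
             ∀ m h → k ≡ m * h → m * suc n ≤ p → suc n ∣ h
  cofactor 0 pq _ = contradiction pq ¬prime[1]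
  cofactor 1 _ _ = cofactor-two
  cofactor n@(suc (suc _)) pq n∣k = cofactor-odd n pq 2≤n (n∣k 2≤n)
    where
    2≤n : 2 ≤ n
    2≤n = s≤s (s≤s z≤n)

  ∣k : ∀ m → 1 ≤ m → m ≤ p → m ∣ k
  ∣k = <-rec _ step
    where
    step : ∀ m → (∀ {i} → i < m → 1 ≤ i → i ≤ p → i ∣ k) → 1 ≤ m → m ≤ p → m ∣ k
    step m rec 1≤m m≤p with m ≟ 1
    ... | yes refl = 1∣ k
    ... | no m≢1 with prime-factor m (≤∧≢⇒< 1≤m (m≢1 ∘ sym))
    ...   | zero , pq , _ = contradiction pq ¬prime[0]
    ...   | suc n , pq , divides-refl i =
      subst (i * suc n ∣_) (sym k≡ih)
        (*-monoʳ-∣ i (cofactor n pq (λ 2≤n → rec n<m (≤-trans (s≤s z≤n) 2≤n) (≤-trans (<⇒≤ n<m) m≤p))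
          i (quotient i∣k) k≡ih m≤p))
      where
      1≤i : 1 ≤ i
      1≤i = >-nonZero⁻¹ i {{m*n≢0⇒m≢0 i {{>-nonZero 1≤m}}}}
      i<m : i < i * suc n
      i<m = m<m*n i (suc n) {{>-nonZero 1≤i}} (nonTrivial⇒n>1 (suc n) {{prime⇒nonTrivial pq}})
      n<m : n < i * suc n
      n<m = m≤n*m (suc n) i {{>-nonZero 1≤i}}
      i∣k : i ∣ k
      i∣k = rec i<m 1≤i (≤-trans (<⇒≤ i<m) m≤p)
      k≡ih : k ≡ i * quotient i∣k
      k≡ih = m∣n⇒n≡m*quotient i∣k

-- Size estimates

^-cancelˡ-< : ∀ n {a b} → a ^ n < b ^ n → a < b
^-cancelˡ-< n {a} {b} lt = ≰⇒> λ b≤a → <⇒≱ lt (^-monoˡ-≤ n b≤a)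

<⇒suc : ∀ {a b} → a < b → ∃ λ c → b ≡ suc c × a ≤ c
<⇒suc (s≤s a≤c) = _ , refl , a≤c

-- For p ≥ 7 the crude estimate x ≤ AB − 1 already suffices.
gap-large : ∀ p {A B z w x} → 7 ≤ p → 2 ≤ A → 1 ≤ B → A ≤ B → B ≤ A ^ 5 →
            A ^ p ≡ suc z → B ^ p ≡ suc w → z * w ≢ x ^ p
gap-large (suc n) {A} {B} {z} {w} {x} (s≤s 6≤n) 2≤A 1≤B A≤B B≤A^5 A^p≡ B^p≡ zw≡x^p =
  <⇒≱ M^n<Z+W Z+W≤M^n
  where
  open ≤-Reasoning
  M = A * B
  1≤A : 1 ≤ A
  1≤A = ≤-trans (s≤s z≤n) 2≤A
  M^p≡ : M ^ suc n ≡ suc z * suc w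
  M^p≡ = trans (*-^-distrib A B (suc n)) (cong₂ _*_ A^p≡ B^p≡)
  expand : ∀ z w → suc z * suc w ≡ suc (z * w + (z + w))
  expand = solve-∀
  x<M : x < M
  x<M = ^-cancelˡ-< (suc n) (begin-strict
    x ^ suc n             ≡⟨ zw≡x^p ⟨
    z * w                 ≤⟨ m≤m+n (z * w) (z + w) ⟩
    z * w + (z + w)       <⟨ n<1+n _ ⟩
    suc (z * w + (z + w)) ≡⟨ expand z w ⟨
    suc z * suc w         ≡⟨ M^p≡ ⟨
    M ^ suc n             ∎)
  -- From `x ≤ M - 1`: `M ^ n ≤ M ^ p - x ^ p`, and this difference is
  -- `suc z * suc w - z * w = z + w + 1`.
  M^n<Z+W : M ^ n < suc z + suc w
  M^n<Z+W = +-cancelˡ-< (x ^ suc n) _ _ (begin-strict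
    x ^ suc n + M ^ n       ≤⟨ +-monoˡ-≤ (M ^ n) (*-monoʳ-≤ x (^-monoˡ-≤ n (<⇒≤ x<M))) ⟩
    x * M ^ n + M ^ n       ≡⟨ +-comm (x * M ^ n) (M ^ n) ⟩
    suc x * M ^ n           ≤⟨ *-monoˡ-≤ (M ^ n) x<M ⟩
    M ^ suc n               ≡⟨ M^p≡ ⟩
    suc z * suc w           ≡⟨ expand z w ⟩
    suc (z * w + (z + w))   ≡⟨ +-suc (z * w) (z + w) ⟨
    z * w + suc (z + w)     <⟨ +-monoʳ-< (z * w) (n<1+n (suc (z + w))) ⟩
    z * w + suc (suc (z + w)) ≡⟨ cong₂ _+_ zw≡x^p (cong suc (sym (+-suc z w))) ⟩
    x ^ suc n + (suc z + suc w) ∎)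
  -- The sum is at most `2 * B * B ^ n`, and `2 * B ≤ A ^ 6 ≤ A ^ n`; this is where `p ≥ 7` enters.
  Z+W≤M^n : suc z + suc w ≤ M ^ n
  Z+W≤M^n = begin
    suc z + suc w           ≡⟨ cong₂ _+_ A^p≡ B^p≡ ⟨
    A ^ suc n + B ^ suc n   ≤⟨ +-monoˡ-≤ (B ^ suc n) (^-monoˡ-≤ (suc n) A≤B) ⟩
    B ^ suc n + B ^ suc n   ≡⟨ regroup B (B ^ n) ⟩
    2 * B * B ^ n           ≤⟨ *-monoˡ-≤ (B ^ n) (*-mono-≤ 2≤A B≤A^5) ⟩
    A ^ 6 * B ^ n           ≤⟨ *-monoˡ-≤ (B ^ n) (^-monoʳ-≤ A {{>-nonZero 1≤A}} 6≤n) ⟩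
    A ^ n * B ^ n           ≡⟨ *-^-distrib A B n ⟨
    M ^ n                   ∎
    where
    regroup : ∀ b y → b * y + b * y ≡ 2 * b * y
    regroup = solve-∀

-- The integers 5 A⁴ x and B (5 A⁵ − 1) would differ by a quantity strictly between 0 and 1:
-- this is the expansion (1 − A⁻⁵)^(1/5) = 1 − A⁻⁵/5 − ….
gap-five : ∀ {A B z w x} → 2 ≤ A → A * A ≤ B → B ≤ A ^ 5 →
           A ^ 5 ≡ suc z → B ^ 5 ≡ suc w → z * w ≢ x ^ 5
gap-five {A} {B} {z} {w} {x} 2≤A A²≤B B≤A^5 A^5≡ B^5≡ zw≡x^5 = <⇒≱ 16E<80s^4 80s^4≤16E
  where
  open ≤-Reasoning
  Z = suc z
  W = suc w
  Y = 5 * A ^ 4 * x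
  V = B * (5 * z + 4)
  K = 3125 * (Z ^ 4 * z)
  -- `R` is `(5 * z + 4) ^ 5 - K`. The two leading terms in the expansion of `(5 * Z - 1) ^ 5` add
  -- up to `K`, leaving `1250 Z^3 - 250 Z^2 + 25 Z - 1`, rewritten in `z` with positive
  -- coefficients.
  R = 1250 * z ^ 3 + 3500 * (z * z) + 3275 * z + 1024
  E = K + W * R
  Y^5≡ : Y ^ 5 ≡ K * w
  Y^5≡ = begin-equality
    Y ^ 5                               ≡⟨ expand ⟩
    3125 * ((A ^ 5) ^ 4 * x ^ 5)        ≡⟨ cong₂ (λ u v → 3125 * (u ^ 4 * v)) A^5≡ (sym zw≡x^5) ⟩
    3125 * (Z ^ 4 * (z * w))            ≡⟨ regroup 3125 (Z ^ 4) z w ⟩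
    K * w                               ∎
    where
    expand : Y ^ 5 ≡ 3125 * ((A ^ 5) ^ 4 * x ^ 5)
    expand = begin-equality
      Y ^ 5                            ≡⟨ *-^-distrib (5 * A ^ 4) x 5 ⟩
      (5 * A ^ 4) ^ 5 * x ^ 5          ≡⟨ cong (_* x ^ 5) (*-^-distrib 5 (A ^ 4) 5) ⟩
      3125 * (A ^ 4) ^ 5 * x ^ 5       ≡⟨ cong (λ u → 3125 * u * x ^ 5) (trans (^-*-assoc A 4 5) (sym (^-*-assoc A 5 4))) ⟩
      3125 * (A ^ 5) ^ 4 * x ^ 5       ≡⟨ *-assoc 3125 ((A ^ 5) ^ 4) (x ^ 5) ⟩
      3125 * ((A ^ 5) ^ 4 * x ^ 5)     ∎
    regroup : ∀ c y z w → c * (y * (z * w)) ≡ c * (y * z) * w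
    regroup = solve-∀
  V^5≡ : V ^ 5 ≡ Y ^ 5 + E
  V^5≡ = begin-equality
    V ^ 5                            ≡⟨ *-^-distrib B (5 * z + 4) 5 ⟩
    B ^ 5 * (5 * z + 4) ^ 5          ≡⟨ cong₂ _*_ B^5≡ (expand z) ⟩
    W * (K + R)                      ≡⟨ regroup K R w ⟩
    K * w + E                        ≡⟨ cong (_+ E) Y^5≡ ⟨
    Y ^ 5 + E                        ∎
    where
    expand : ∀ z →
      let fourth : ℕ → ℕ
          fourth y = y * (y * (y * (y * 1)))
          y = 5 * z + 4
      in y * fourth y ≡ 3125 * (fourth (suc z) * z) +
           (1250 * (z * (z * (z * 1))) + 3500 * (z * z) + 3275 * z + 1024)
    expand = solve-∀
    regroup : ∀ k r w → suc w * (k + r) ≡ k * w + (k + suc w * r)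
    regroup = solve-∀
  0<E : 0 < E
  0<E = <-≤-trans (s≤s z≤n) (≤-trans (m≤n+m 1024 (1250 * z ^ 3 + 3500 * (z * z) + 3275 * z))
          (≤-trans (m≤n*m R W) (m≤n+m (W * R) K)))
  Y<V : Y < V
  Y<V = ^-cancelˡ-< 5 (begin-strict
    Y ^ 5       <⟨ m<m+n (Y ^ 5) 0<E ⟩
    Y ^ 5 + E   ≡⟨ V^5≡ ⟨
    V ^ 5       ∎)
  s = proj₁ (<⇒suc Y<V)
  V≡ : V ≡ suc s
  V≡ = proj₁ (proj₂ (<⇒suc Y<V))
  Y≤s : Y ≤ s
  Y≤s = proj₂ (proj₂ (<⇒suc Y<V))
  -- Integrality enters here: `Y < V` forces `Y ≤ V - 1 = s`, so the fifth powers differ by at least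
  -- `5 * s ^ 4`.
  5s^4≤E : 5 * s ^ 4 ≤ E
  5s^4≤E = +-cancelˡ-≤ (s ^ 5) _ _ (begin
    s ^ 5 + 5 * s ^ 4               ≤⟨ m≤m+n _ (10 * s ^ 3 + 10 * (s * s) + 5 * s + 1) ⟩
    s ^ 5 + 5 * s ^ 4 + (10 * s ^ 3 + 10 * (s * s) + 5 * s + 1) ≡⟨ expand s ⟨
    suc s ^ 5                       ≡⟨ cong (_^ 5) V≡ ⟨
    V ^ 5                           ≡⟨ V^5≡ ⟩
    Y ^ 5 + E                       ≤⟨ +-monoˡ-≤ E (^-monoˡ-≤ 5 Y≤s) ⟩
    s ^ 5 + E                       ∎)
    where
    expand : ∀ s →
      let cube : ℕ → ℕ
          cube y = y * (y * (y * 1))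
          fifth : ℕ → ℕ
          fifth y = y * (y * cube y)
      in fifth (suc s) ≡ fifth s + 5 * (s * cube s) + (10 * cube s + 10 * (s * s) + 5 * s + 1)
    expand = solve-∀
  1≤A : 1 ≤ A
  1≤A = ≤-trans (s≤s z≤n) 2≤A
  1≤B : 1 ≤ B
  1≤B = ≤-trans (*-mono-≤ 1≤A 1≤A) A²≤B
  31≤z : 31 ≤ z
  31≤z = s≤s⁻¹ (subst (32 ≤_) A^5≡ (^-monoˡ-≤ 5 2≤A))
  -- `s` is `5 * (B * Z) - B - 1`; replacing 5 by 9/2 absorbs the lower-order terms.
  9BZ≤2s : 9 * (B * Z) ≤ 2 * s
  9BZ≤2s = +-cancelʳ-≤ 2 _ _ (begin
    9 * (B * Z) + 2                   ≡⟨ regroup B z ⟩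
    9 * (B * z) + 8 * B + (B + 2 * 1) ≤⟨ +-monoʳ-≤ (9 * (B * z) + 8 * B) (+-monoʳ-≤ B (*-monoʳ-≤ 2 1≤B)) ⟩
    9 * (B * z) + 8 * B + 3 * B       ≤⟨ +-monoʳ-≤ (9 * (B * z) + 8 * B) (*-monoˡ-≤ B (≤-trans (s≤s (s≤s (s≤s z≤n))) 31≤z)) ⟩
    9 * (B * z) + 8 * B + z * B       ≡⟨ regroup′ B z ⟩
    2 * V                             ≡⟨ cong (2 *_) V≡ ⟩
    2 * suc s                         ≡⟨ *-suc 2 s ⟩
    2 + 2 * s                         ≡⟨ +-comm 2 (2 * s) ⟩
    2 * s + 2                         ∎)
    where
    regroup : ∀ b z → 9 * (b * suc z) + 2 ≡ 9 * (b * z) + 8 * b + (b + 2 * 1)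
    regroup = solve-∀
    regroup′ : ∀ b z → 9 * (b * z) + 8 * b + z * b ≡ 2 * (b * (5 * z + 4))
    regroup′ = solve-∀
  8Z≤B^4 : 8 * Z ≤ B ^ 4
  8Z≤B^4 = begin
    8 * Z              ≡⟨ cong (8 *_) A^5≡ ⟨
    8 * A ^ 5          ≤⟨ *-monoˡ-≤ (A ^ 5) (^-monoˡ-≤ 3 2≤A) ⟩
    A ^ 3 * A ^ 5      ≡⟨ regroup A ⟩
    (A * A) ^ 4        ≤⟨ ^-monoˡ-≤ 4 A²≤B ⟩
    B ^ 4              ∎
    where
    regroup : ∀ a → a * (a * (a * 1)) * (a * (a * (a * (a * (a * 1))))) ≡
                    a * a * (a * a * (a * a * (a * a * 1)))
    regroup = solve-∀
  R≤ : R ≤ 1250 * Z ^ 3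
  R≤ = begin
    R                                        ≤⟨ m≤m+n R (250 * (z * z) + 475 * z + 226) ⟩
    R + (250 * (z * z) + 475 * z + 226)      ≡⟨ regroup z ⟩
    1250 * Z ^ 3                             ∎
    where
    regroup : ∀ z →
      let cube : ℕ → ℕ
          cube y = y * (y * (y * 1))
      in 1250 * cube z + 3500 * (z * z) + 3275 * z + 1024 + (250 * (z * z) + 475 * z + 226) ≡
         1250 * cube (suc z)
    regroup = solve-∀
  P = B ^ 4 * Z ^ 4
  -- Both parts of `E` are measured against `P`: the part `K` through `8 * Z ≤ B ^ 4`, the part
  -- `W * R` through `B ≤ Z`. The factor 16 clears the denominator of (9/2)^4.
  16E≤ : 16 * E ≤ 26250 * P
  16E≤ = begin
    16 * E
      ≤⟨ *-monoʳ-≤ 16 (+-mono-≤ (*-monoʳ-≤ 3125 (*-monoʳ-≤ (Z ^ 4) (n≤1+n z))) (*-monoʳ-≤ W R≤)) ⟩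
    16 * (3125 * (Z ^ 4 * Z) + W * (1250 * Z ^ 3))
      ≡⟨ cong (λ u → 16 * (3125 * (Z ^ 4 * Z) + u * (1250 * Z ^ 3))) B^5≡ ⟨
    16 * (3125 * (Z ^ 4 * Z) + B ^ 5 * (1250 * Z ^ 3))
      ≡⟨ regroup 3125 1250 (Z ^ 4) Z B (B ^ 4) (Z ^ 3) ⟩
    6250 * (8 * Z * Z ^ 4) + 20000 * (B * (B ^ 4 * Z ^ 3))
      ≤⟨ +-mono-≤ (*-monoʳ-≤ 6250 (*-monoˡ-≤ (Z ^ 4) 8Z≤B^4))
                  (*-monoʳ-≤ 20000 (*-monoˡ-≤ (B ^ 4 * Z ^ 3) (subst (B ≤_) A^5≡ B≤A^5))) ⟩
    6250 * P + 20000 * (Z * (B ^ 4 * Z ^ 3))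
      ≡⟨ regroup′ 6250 20000 Z (B ^ 4) (Z ^ 3) ⟩
    26250 * P               ∎
    where
    regroup : ∀ k l y z b c x → 16 * (k * (y * z) + b * c * (l * x)) ≡
                                2 * k * (8 * z * y) + 16 * l * (b * (c * x))
    regroup = solve-∀
    regroup′ : ∀ k l z c x → k * (c * (z * x)) + l * (z * (c * x)) ≡ (k + l) * (c * (z * x))
    regroup′ = solve-∀
  80s^4≤16E : 16 * (5 * s ^ 4) ≤ 16 * E
  80s^4≤16E = *-monoʳ-≤ 16 5s^4≤E
  6561P≤16s^4 : 6561 * P ≤ 16 * s ^ 4
  6561P≤16s^4 = begin
    6561 * P                    ≡⟨ cong (6561 *_) (*-^-distrib B Z 4) ⟨
    9 ^ 4 * (B * Z) ^ 4         ≡⟨ *-^-distrib 9 (B * Z) 4 ⟨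
    (9 * (B * Z)) ^ 4           ≤⟨ ^-monoˡ-≤ 4 9BZ≤2s ⟩
    (2 * s) ^ 4                 ≡⟨ *-^-distrib 2 s 4 ⟩
    16 * s ^ 4                  ∎
  0<P : 0 < P
  0<P = *-mono-≤ (m^n>0 B {{>-nonZero 1≤B}} 4) (m^n>0 Z 4)
  16E<80s^4 : 16 * E < 16 * (5 * s ^ 4)
  16E<80s^4 = begin-strict
    16 * E                          ≤⟨ 16E≤ ⟩
    26250 * P                       <⟨ *-monoˡ-< P {{>-nonZero 0<P}} (<ᵇ⇒< 26250 32805 _) ⟩
    32805 * P                       ≡⟨ *-assoc 5 6561 P ⟩
    5 * (6561 * P)                  ≤⟨ *-monoʳ-≤ 5 6561P≤16s^4 ⟩
    5 * (16 * s ^ 4)                ≡⟨ regroup (s ^ 4) ⟩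
    16 * (5 * s ^ 4)                ∎
    where
    regroup : ∀ y → 5 * (16 * y) ≡ 16 * (5 * y)
    regroup = solve-∀

-- Here the Padé approximant (1 − A⁻³)^(1/3) ≈ (3 − 2A⁻³)/(3 − A⁻³) puts the integers
-- x (3A³ − 1) and A B (3A³ − 2) at a distance strictly between 0 and 1.
gap-three : ∀ {A B z w x} → 2 ≤ A → 1 ≤ B → 25 * A ^ 4 ≤ 16 * (B * B) → B ≤ A ^ 5 →
            A ^ 3 ≡ suc z → B ^ 3 ≡ suc w → z * w ≢ x ^ 3
gap-three {A} {B} {z} {w} {x} 2≤A 1≤B 25A^4≤16B² B≤A^5 A^3≡ B^3≡ zw≡x^3 =
  <⇒≱ E<192s² 192s²≤64E
  where
  open ≤-Reasoning
  Z = suc z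
  W = suc w
  M = A * B
  Q = 3 * z + 2
  Y = x * Q
  V = M * (3 * z + 1)
  -- `E` is `V ^ 3 - Y ^ 3`. It is small because `Z * (3 * z + 1) ^ 3` exceeds `z * Q ^ 3` by only
  -- `2 * z + 1`, which expresses the accuracy of the approximant.
  E = z * Q ^ 3 + W * (2 * z + 1)
  V^3≡ : V ^ 3 ≡ Y ^ 3 + E
  V^3≡ = begin-equality
    V ^ 3                              ≡⟨ *-^-distrib M (3 * z + 1) 3 ⟩
    M ^ 3 * (3 * z + 1) ^ 3            ≡⟨ cong (_* (3 * z + 1) ^ 3) (*-^-distrib A B 3) ⟩
    A ^ 3 * B ^ 3 * (3 * z + 1) ^ 3    ≡⟨ cong₂ (λ u v → u * v * (3 * z + 1) ^ 3) A^3≡ B^3≡ ⟩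
    Z * W * (3 * z + 1) ^ 3            ≡⟨ expand z w ⟩
    z * w * Q ^ 3 + E                  ≡⟨ cong (λ u → u * Q ^ 3 + E) zw≡x^3 ⟩
    x ^ 3 * Q ^ 3 + E                  ≡⟨ cong (_+ E) (*-^-distrib x Q 3) ⟨
    Y ^ 3 + E                          ∎
    where
    expand : ∀ z w →
      let cube : ℕ → ℕ
          cube y = y * (y * (y * 1))
      in suc z * suc w * cube (3 * z + 1) ≡
         z * w * cube (3 * z + 2) + (z * cube (3 * z + 2) + suc w * (2 * z + 1))
    expand = solve-∀
  0<E : 0 < E
  0<E = <-≤-trans (s≤s z≤n) (≤-trans (m≤n+m 1 (2 * z))
          (≤-trans (m≤n*m (2 * z + 1) W) (m≤n+m (W * (2 * z + 1)) (z * Q ^ 3))))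
  Y<V : Y < V
  Y<V = ^-cancelˡ-< 3 (begin-strict
    Y ^ 3       <⟨ m<m+n (Y ^ 3) 0<E ⟩
    Y ^ 3 + E   ≡⟨ V^3≡ ⟨
    V ^ 3       ∎)
  s = proj₁ (<⇒suc Y<V)
  V≡ : V ≡ suc s
  V≡ = proj₁ (proj₂ (<⇒suc Y<V))
  Y≤s : Y ≤ s
  Y≤s = proj₂ (proj₂ (<⇒suc Y<V))
  3s²≤E : 3 * (s * s) ≤ E
  3s²≤E = +-cancelˡ-≤ (s ^ 3) _ _ (begin
    s ^ 3 + 3 * (s * s)                   ≤⟨ m≤m+n _ (3 * s + 1) ⟩
    s ^ 3 + 3 * (s * s) + (3 * s + 1)     ≡⟨ expand s ⟨
    suc s ^ 3                             ≡⟨ cong (_^ 3) V≡ ⟨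
    V ^ 3                                 ≡⟨ V^3≡ ⟩
    Y ^ 3 + E                             ≤⟨ +-monoˡ-≤ E (^-monoˡ-≤ 3 Y≤s) ⟩
    s ^ 3 + E                             ∎)
    where
    expand : ∀ s →
      let cube : ℕ → ℕ
          cube y = y * (y * (y * 1))
      in cube (suc s) ≡ cube s + 3 * (s * s) + (3 * s + 1)
    expand = solve-∀
  1≤A : 1 ≤ A
  1≤A = ≤-trans (s≤s z≤n) 2≤A
  1≤M : 1 ≤ M
  1≤M = *-mono-≤ 1≤A 1≤B
  7≤z : 7 ≤ z
  7≤z = s≤s⁻¹ (subst (8 ≤_) A^3≡ (^-monoˡ-≤ 3 2≤A))
  -- `s` is `3 * (M * Z) - 2 * M - 1`; lowering 3 to 21/8 absorbs the rest because `Z` is at least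
  -- 8.
  21MZ≤8s : 21 * (M * Z) ≤ 8 * s
  21MZ≤8s = +-cancelʳ-≤ 8 _ _ (begin
    21 * (M * Z) + 8 * 1           ≤⟨ +-monoʳ-≤ (21 * (M * Z)) (*-monoʳ-≤ 8 1≤M) ⟩
    21 * (M * Z) + 8 * M           ≡⟨ regroup M z ⟩
    21 * (M * z) + 8 * M + 3 * (7 * M)
      ≤⟨ +-monoʳ-≤ (21 * (M * z) + 8 * M) (*-monoʳ-≤ 3 (*-monoˡ-≤ M 7≤z)) ⟩
    21 * (M * z) + 8 * M + 3 * (z * M) ≡⟨ regroup′ M z ⟩
    8 * V                          ≡⟨ cong (8 *_) V≡ ⟩
    8 * suc s                      ≡⟨ *-suc 8 s ⟩
    8 + 8 * s                      ≡⟨ +-comm 8 (8 * s) ⟩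
    8 * s + 8                      ∎)
    where
    regroup : ∀ m z → 21 * (m * suc z) + 8 * m ≡ 21 * (m * z) + 8 * m + 3 * (7 * m)
    regroup = solve-∀
    regroup′ : ∀ m z → 21 * (m * z) + 8 * m + 3 * (z * m) ≡ 8 * (m * (3 * z + 1))
    regroup′ = solve-∀
  P = M * Z * (M * Z)
  0<P : 0 < P
  0<P = *-mono-≤ (*-mono-≤ 1≤M (s≤s z≤n)) (*-mono-≤ 1≤M (s≤s z≤n))
  25Z^4≤16P : 25 * Z ^ 4 ≤ 16 * P
  25Z^4≤16P = begin
    25 * Z ^ 4                             ≡⟨ regroup 25 Z ⟩
    25 * (Z * Z) * (Z * Z)                 ≡⟨ cong (λ u → 25 * (u * u) * (Z * Z)) A^3≡ ⟨
    25 * (A ^ 3 * A ^ 3) * (Z * Z)         ≡⟨ regroup′ 25 A Z ⟩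
    25 * A ^ 4 * (A * A * (Z * Z))         ≤⟨ *-monoˡ-≤ (A * A * (Z * Z)) 25A^4≤16B² ⟩
    16 * (B * B) * (A * A * (Z * Z))       ≡⟨ regroup″ 16 A B Z ⟩
    16 * P                                 ∎
    where
    regroup : ∀ k z → k * (z * (z * (z * (z * 1)))) ≡ k * (z * z) * (z * z)
    regroup = solve-∀
    regroup′ : ∀ k a z → k * (a * (a * (a * 1)) * (a * (a * (a * 1)))) * (z * z) ≡
                         k * (a * (a * (a * (a * 1)))) * (a * a * (z * z))
    regroup′ = solve-∀
    regroup″ : ∀ k a b z → k * (b * b) * (a * a * (z * z)) ≡ k * (a * b * z * (a * b * z))
    regroup″ = solve-∀
  WZ≤P : W * Z ≤ P
  WZ≤P = begin
    W * Z                                 ≡⟨ cong (_* Z) B^3≡ ⟨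
    B ^ 3 * Z                             ≡⟨ regroup B Z ⟩
    B * (B * B * Z)                       ≤⟨ *-monoˡ-≤ (B * B * Z) B≤A^5 ⟩
    A ^ 5 * (B * B * Z)                   ≡⟨ regroup′ A B Z ⟩
    A ^ 3 * (A * A * (B * B) * Z)         ≡⟨ cong (_* (A * A * (B * B) * Z)) A^3≡ ⟩
    Z * (A * A * (B * B) * Z)             ≡⟨ regroup″ A B Z ⟩
    P                                     ∎
    where
    regroup : ∀ b z → b * (b * (b * 1)) * z ≡ b * (b * b * z)
    regroup = solve-∀
    regroup′ : ∀ a b z → a * (a * (a * (a * (a * 1)))) * (b * b * z) ≡
                         a * (a * (a * 1)) * (a * a * (b * b) * z)
    regroup′ = solve-∀
    regroup″ : ∀ a b z → z * (a * a * (b * b) * z) ≡ a * b * z * (a * b * z)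
    regroup″ = solve-∀
  E≤ : E ≤ 27 * Z ^ 4 + 2 * (W * Z)
  E≤ = begin
    z * Q ^ 3 + W * (2 * z + 1)
      ≤⟨ +-mono-≤ (*-mono-≤ (n≤1+n z) (^-monoˡ-≤ 3 Q≤3Z)) (*-monoʳ-≤ W 2z+1≤2Z) ⟩
    Z * (3 * Z) ^ 3 + W * (2 * Z)         ≡⟨ regroup Z W ⟩
    27 * Z ^ 4 + 2 * (W * Z)              ∎
    where
    Q≤3Z : Q ≤ 3 * Z
    Q≤3Z = ≤-trans (+-monoʳ-≤ (3 * z) (n≤1+n 2)) (≤-reflexive (trans (+-comm (3 * z) 3) (sym (*-suc 3 z))))
    2z+1≤2Z : 2 * z + 1 ≤ 2 * Z
    2z+1≤2Z = ≤-trans (+-monoʳ-≤ (2 * z) (n≤1+n 1)) (≤-reflexive (trans (+-comm (2 * z) 2) (sym (*-suc 2 z))))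
    regroup : ∀ z w → z * (3 * z * (3 * z * (3 * z * 1))) + w * (2 * z) ≡
                      27 * (z * (z * (z * (z * 1)))) + 2 * (w * z)
    regroup = solve-∀
  192s²≤64E : 25 * (64 * (3 * (s * s))) ≤ 25 * (64 * E)
  192s²≤64E = *-monoʳ-≤ 25 (*-monoʳ-≤ 64 3s²≤E)
  -- The factors 25 and 64 clear the denominators of `Z ^ 4 ≤ (16/25) P` and of
  -- `s * s ≥ (21/8)^2 P`.
  E<192s² : 25 * (64 * E) < 25 * (64 * (3 * (s * s)))
  E<192s² = begin-strict
    25 * (64 * E)                              ≤⟨ *-monoʳ-≤ 25 (*-monoʳ-≤ 64 E≤) ⟩
    25 * (64 * (27 * Z ^ 4 + 2 * (W * Z)))     ≡⟨ regroup 25 64 27 2 (Z ^ 4) (W * Z) ⟩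
    1728 * (25 * Z ^ 4) + 3200 * (W * Z)
      ≤⟨ +-mono-≤ (*-monoʳ-≤ 1728 25Z^4≤16P) (*-monoʳ-≤ 3200 WZ≤P) ⟩
    1728 * (16 * P) + 3200 * P                 ≡⟨ regroup′ 1728 16 3200 P ⟩
    30848 * P                                  <⟨ *-monoˡ-< P {{>-nonZero 0<P}} (<ᵇ⇒< 30848 33075 _) ⟩
    33075 * P                                  ≡⟨ regroup″ 75 21 (M * Z) ⟩
    75 * (21 * (M * Z) * (21 * (M * Z)))       ≤⟨ *-monoʳ-≤ 75 (*-mono-≤ 21MZ≤8s 21MZ≤8s) ⟩
    75 * (8 * s * (8 * s))                     ≡⟨ regroup‴ 25 3 8 s ⟩
    25 * (64 * (3 * (s * s)))                  ∎
    where
    regroup : ∀ k l m n x y → k * (l * (m * x + n * y)) ≡ l * m * (k * x) + k * l * n * y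
    regroup = solve-∀
    regroup′ : ∀ k l m p → k * (l * p) + m * p ≡ (k * l + m) * p
    regroup′ = solve-∀
    regroup″ : ∀ k l x → k * (l * l) * (x * x) ≡ k * (l * x * (l * x))
    regroup″ = solve-∀
    regroup‴ : ∀ k l m s → k * l * (m * s * (m * s)) ≡ k * (m * m * (l * (s * s)))
    regroup‴ = solve-∀

-- Vieta jumping

-- A² + B² + C² = 1 + 2ABC says that (A² − 1)(B² − 1) = (AB − C)²; it is symmetric and quadratic in
-- each variable, so Vieta jumping applies.
record Triple (a b c : ℕ) : Set where
  constructor triple
  field equation : a * a + b * b + c * c ≡ 1 + 2 * (a * b * c)

rotate : ∀ {a b c} → Triple a b c → Triple b c a
rotate {a} {b} {c} (triple t) = triple
  (trans (regroup a b c) (trans t (cong (λ u → 1 + 2 * u) (regroup′ a b c))))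
  where
  regroup : ∀ a b c → b * b + c * c + a * a ≡ a * a + b * b + c * c
  regroup = solve-∀
  regroup′ : ∀ a b c → a * b * c ≡ b * c * a
  regroup′ = solve-∀

swap : ∀ {a b c} → Triple a b c → Triple b a c
swap {a} {b} {c} (triple t) = triple (trans (cong (_+ c * c) (+-comm (b * b) (a * a)))
  (trans t (cong (λ u → 1 + 2 * (u * c)) (*-comm a b))))

-- As a quadratic in its last entry the equation has roots `c` and `d` with sum `2 * (a * b)` and
-- product `a * a + b * b - 1`; a largest entry `c` is the larger root.
vieta : ∀ {a b c} → 2 ≤ a → 2 ≤ b → a ≤ c → b ≤ c → Triple a b c →
        ∃ λ d → c + d ≡ 2 * (a * b) × 1 ≤ d × d < c × Triple a b d
vieta {a} {b} {c} 2≤a 2≤b a≤c b≤c (triple t) = d , c+d≡ , 1≤d , d<c , t′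
  where
  open ≤-Reasoning
  s = 2 * (a * b)
  -- If `s ≤ c`, then `s * c ≤ c * c`, and the equation would force `a * a + b * b ≤ 1`.
  c<s : c < s
  c<s = ≰⇒> λ s≤c → <⇒≱ (begin-strict
    1 + 2 * (a * b * c)      <⟨ +-monoˡ-< (2 * (a * b * c)) {1} (≤-trans (s≤s (s≤s z≤n)) (≤-trans (*-mono-≤ 2≤a 2≤a) (m≤m+n (a * a) (b * b)))) ⟩
    a * a + b * b + 2 * (a * b * c) ≡⟨ cong (a * a + b * b +_) (*-assoc 2 (a * b) c) ⟨
    a * a + b * b + s * c    ∎)
    (begin
    a * a + b * b + s * c    ≤⟨ +-monoʳ-≤ (a * a + b * b) (*-monoˡ-≤ c s≤c) ⟩
    a * a + b * b + c * c    ≡⟨ t ⟩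
    1 + 2 * (a * b * c)      ∎)
  d = s ∸ c
  c+d≡ : c + d ≡ s
  c+d≡ = m+[n∸m]≡n (<⇒≤ c<s)
  1≤d : 1 ≤ d
  1≤d = m<n⇒0<n∸m c<s
  cd+1≡ : a * a + b * b ≡ 1 + c * d
  cd+1≡ = +-cancelʳ-≡ (c * c) _ _ (begin-equality
    a * a + b * b + c * c    ≡⟨ t ⟩
    1 + 2 * (a * b * c)      ≡⟨ cong suc (*-assoc 2 (a * b) c) ⟨
    1 + s * c                ≡⟨ cong (λ u → 1 + u * c) c+d≡ ⟨
    1 + (c + d) * c          ≡⟨ regroup c d ⟩
    1 + c * d + c * c        ∎)
    where
    regroup : ∀ c d → 1 + (c + d) * c ≡ 1 + c * d + c * c
    regroup = solve-∀
  t′ : Triple a b d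
  t′ = triple (begin-equality
    a * a + b * b + d * d    ≡⟨ cong (_+ d * d) cd+1≡ ⟩
    1 + c * d + d * d        ≡⟨ regroup c d ⟩
    1 + (c + d) * d          ≡⟨ cong (λ u → 1 + u * d) c+d≡ ⟩
    1 + s * d                ≡⟨ cong suc (*-assoc 2 (a * b) d) ⟩
    1 + 2 * (a * b * d)      ∎)
    where
    regroup : ∀ c d → 1 + c * d + d * d ≡ 1 + (c + d) * d
    regroup = solve-∀
  -- If c ≤ d then (c − m)(d − m) ≥ 0 for m = max(a , b), contradicting m² (min(a , b) − 1) > 0.
  m≰ : ∀ {m l} → 2 ≤ l → l ≤ m → a * b ≡ l * m → a * a + b * b ≡ l * l + m * m → m ≤ c → c ≰ d
  m≰ {m} {l} 2≤l l≤m ab≡ squares m≤c c≤d with m≤n⇒∃[o]m+o≡n m≤c | m≤n⇒∃[o]m+o≡n (≤-trans m≤c c≤d)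
  ... | e , m+e≡c | f , m+f≡d = <⇒≱ (begin-strict
    m * (2 * (a * b))                ≡⟨ cong (m *_) (trans (sym c+d≡) (cong₂ _+_ (sym m+e≡c) (sym m+f≡d))) ⟩
    m * (m + e + (m + f))            ≤⟨ m≤m+n _ (e * f) ⟩
    m * (m + e + (m + f)) + e * f    ≡⟨ regroup m e f ⟩
    (m + e) * (m + f) + m * m        ≡⟨ cong₂ (λ u v → u * v + m * m) m+e≡c m+f≡d ⟩
    c * d + m * m                    <⟨ n<1+n _ ⟩
    1 + c * d + m * m                ≡⟨ cong (_+ m * m) (trans (sym cd+1≡) squares) ⟩
    l * l + m * m + m * m            ∎)
    (begin
    l * l + m * m + m * m            ≤⟨ +-monoˡ-≤ (m * m) (+-monoˡ-≤ (m * m) (*-mono-≤ l≤m l≤m)) ⟩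
    m * m + m * m + m * m            ≤⟨ m≤m+n _ (m * m) ⟩
    m * m + m * m + m * m + m * m    ≡⟨ regroup′ m ⟩
    m * (2 * (2 * m))                ≤⟨ *-monoʳ-≤ m (*-monoʳ-≤ 2 (*-monoˡ-≤ m 2≤l)) ⟩
    m * (2 * (l * m))                ≡⟨ cong (λ u → m * (2 * u)) ab≡ ⟨
    m * (2 * (a * b))                ∎)
    where
    regroup : ∀ m e f → m * (m + e + (m + f)) + e * f ≡ (m + e) * (m + f) + m * m
    regroup = solve-∀
    regroup′ : ∀ m → m * m + m * m + m * m + m * m ≡ m * (2 * (2 * m))
    regroup′ = solve-∀
  d<c : d < c
  d<c with ≤-total a b
  ... | inj₁ a≤b = ≰⇒> (m≰ 2≤a a≤b refl refl b≤c)
  ... | inj₂ b≤a = ≰⇒> (m≰ 2≤b b≤a (*-comm a b) (+-comm (a * a) (b * b)) a≤c)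

SameTwoPower : ℕ → ℕ → Set
SameTwoPower a c = ∀ s → (2 ^ s ∣ a → 2 ^ s ∣ c) × (2 ^ s ∣ c → 2 ^ s ∣ a)

SameTwoPower-sym : ∀ {a c} → SameTwoPower a c → SameTwoPower c a
SameTwoPower-sym st s = proj₂ (st s) , proj₁ (st s)

-- Whatever power of 2 divides `c`, the sum `a + a′` is divisible by one more. As `a′` has the
-- valuation of `c`, so does the other summand `a`.
SameTwoPower-jump : ∀ {a a′ c} o → a + a′ ≡ 2 * (c * o) → SameTwoPower a′ c → SameTwoPower a c
SameTwoPower-jump {a} {a′} {c} o a+a′≡ st s = to s , from s
  where
  2c∣ : ∀ {d} → d ∣ c → 2 * d ∣ a + a′
  2c∣ {d} d∣c = subst (2 * d ∣_) (sym a+a′≡) (*-monoʳ-∣ 2 (∣m⇒∣m*n o d∣c))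
  to : ∀ s → 2 ^ s ∣ a → 2 ^ s ∣ c
  to zero _ = 1∣ c
  -- The recursive call puts `2 ^ s` into `c`, hence `2 ^ suc s` into `a + a′`, hence into `a′`, and
  -- `st` carries it to `c`.
  to (suc s) 2^∣a = proj₁ (st (suc s)) (∣m+n∣m⇒∣n (2c∣ (to s (∣-trans (n∣m*n 2) 2^∣a))) 2^∣a)
  from : ∀ s → 2 ^ s ∣ c → 2 ^ s ∣ a
  from s 2^∣c = ∣m+n∣m⇒∣n (subst (2 ^ s ∣_) (+-comm a a′) (∣-trans (n∣m*n 2) (2c∣ 2^∣c))) (proj₂ (st s) 2^∣c)

-- With third entry 1 the equation reads `(c - a)^2 = 0`.
triple-one-≤ : ∀ {a c} → a ≤ c → Triple a c 1 → a ≡ c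
triple-one-≤ {a} {c} a≤c (triple t) with m≤n⇒∃[o]m+o≡n a≤c
... | e , refl = sym (trans (cong (a +_) (e≡0 e (+-cancelˡ-≡ (2 * (a * (a + e)) + 1) _ _ (begin
    2 * (a * (a + e)) + 1 + e * e              ≡⟨ regroup a e ⟩
    a * a + (a + e) * (a + e) + 1              ≡⟨ t ⟩
    1 + 2 * (a * (a + e) * 1)                  ≡⟨ regroup′ a e ⟩
    2 * (a * (a + e)) + 1 + 0                  ∎)))) (+-identityʳ a))
  where
  open ≡-Reasoning
  regroup : ∀ a e → 2 * (a * (a + e)) + 1 + e * e ≡ a * a + (a + e) * (a + e) + 1
  regroup = solve-∀
  regroup′ : ∀ a e → 1 + 2 * (a * (a + e) * 1) ≡ 2 * (a * (a + e)) + 1 + 0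
  regroup′ = solve-∀
  e≡0 : ∀ e → e * e ≡ 0 → e ≡ 0
  e≡0 zero _ = refl

triple-one : ∀ {a c} → Triple a c 1 → a ≡ c
triple-one {a} {c} t with ≤-total a c
... | inj₁ a≤c = triple-one-≤ a≤c t
... | inj₂ c≤a = sym (triple-one-≤ c≤a (swap t))

-- Descent on `a + c + o`, jumping at a largest entry. A jump preserves parity, since old and new
-- entry have an even sum. Jumping at `o` leaves `a` and `c` alone; jumping at an even entry is
-- covered by `SameTwoPower-jump`. The descent stops at `o = 1`, where `a = c`.
triple⇒SameTwoPower : ∀ {a c o} → 2 ∣ a → 2 ∣ c → 2 ∤ o → 1 ≤ a → 1 ≤ c →
                      Triple a c o → SameTwoPower a c
triple⇒SameTwoPower = <-rec P step _ refl
  where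
  P : ℕ → Set
  P n = ∀ {a c o} → a + c + o ≡ n → 2 ∣ a → 2 ∣ c → 2 ∤ o → 1 ≤ a → 1 ≤ c →
        Triple a c o → SameTwoPower a c
  2≤even : ∀ {a} → 2 ∣ a → 1 ≤ a → 2 ≤ a
  2≤even 2∣a 1≤a = ∣⇒≤ {{>-nonZero 1≤a}} 2∣a
  jump-even : ∀ {a c o} → (∀ {d} → d < c → P (a + d + o)) →
              2 ∣ a → 2 ∣ c → 2 ∤ o → 1 ≤ a → 1 ≤ c → 2 ≤ o → a ≤ c → o ≤ c →
              Triple a c o → SameTwoPower a c
  jump-even {a} {c} {o} rec 2∣a 2∣c 2∤o 1≤a 1≤c 2≤o a≤c o≤c t =
    let d , c+d≡ , 1≤d , d<c , t′ = vieta (2≤even 2∣a 1≤a) 2≤o a≤c o≤c (swap (rotate (rotate t)))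
        2∣d = ∣m+n∣m⇒∣n (subst (2 ∣_) (sym c+d≡) (m∣m*n (a * o))) 2∣c
    in SameTwoPower-sym (SameTwoPower-jump o c+d≡ (SameTwoPower-sym
         (rec d<c refl 2∣a 2∣d 2∤o 1≤a 1≤d (swap (rotate (rotate t′))))))
  2≤odd : ∀ {o} → 2 ∤ o → o ≢ 1 → 2 ≤ o
  2≤odd {zero} 2∤o _ = contradiction (2 ∣0) 2∤o
  2≤odd {1} _ o≢1 = contradiction refl o≢1
  2≤odd {suc (suc o)} _ _ = s≤s (s≤s z≤n)
  jump-odd : ∀ {a c o} → (∀ {d} → d < o → P (a + c + d)) →
             2 ∣ a → 2 ∣ c → 2 ∤ o → 1 ≤ a → 1 ≤ c → a ≤ o → c ≤ o →
             Triple a c o → SameTwoPower a c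
  jump-odd {a} {c} {o} rec 2∣a 2∣c 2∤o 1≤a 1≤c a≤o c≤o t =
    let d , o+d≡ , 1≤d , d<o , t′ = vieta (2≤even 2∣a 1≤a) (2≤even 2∣c 1≤c) a≤o c≤o t
        2∤d = λ 2∣d → 2∤o (∣m+n∣m⇒∣n (subst (2 ∣_) (trans (sym o+d≡) (+-comm o d)) (m∣m*n (a * c))) 2∣d)
    in rec d<o refl 2∣a 2∣c 2∤d 1≤a 1≤c t′
  step : ∀ n → (∀ {i} → i < n → P i) → P n
  step _ rec {a} {c} {o} refl 2∣a 2∣c 2∤o 1≤a 1≤c t with o ≟ 1
  ... | yes refl = subst (SameTwoPower a) (triple-one t) λ _ → (λ d → d) , λ d → d
  ... | no o≢1 with ≤-total a c | ≤-total o c | ≤-total o a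
  ...   | inj₁ a≤c | inj₁ o≤c | _ =
    jump-even (λ d<c → rec (+-monoˡ-< o (+-monoʳ-< a d<c))) 2∣a 2∣c 2∤o 1≤a 1≤c (2≤odd 2∤o o≢1) a≤c o≤c t
  ...   | inj₂ c≤a | _ | inj₁ o≤a = SameTwoPower-sym
    (jump-even (λ {d} d<a → rec (+-monoˡ-< o (subst (c + d <_) (+-comm c a) (+-monoʳ-< c d<a))))
      2∣c 2∣a 2∤o 1≤c 1≤a (2≤odd 2∤o o≢1) c≤a o≤a (swap t))
  ...   | inj₁ a≤c | inj₂ c≤o | _ = jump-odd (λ d<o → rec (+-monoʳ-< (a + c) d<o)) 2∣a 2∣c 2∤o 1≤a 1≤c (≤-trans a≤c c≤o) c≤o t
  ...   | inj₂ c≤a | _ | inj₂ a≤o = jump-odd (λ d<o → rec (+-monoʳ-< (a + c) d<o)) 2∣a 2∣c 2∤o 1≤a 1≤c a≤o (≤-trans c≤a a≤o) t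

-- Odd exponents

-- This excludes all exponents `p ≥ 3` at once: an even `y` would put 8 into `y ^ p`.
OddResidue : ℕ → ℕ → Set
OddResidue b k = 2 ∣ powerProduct b k × 8 ∤ powerProduct b k

oddResidue? : ∀ b k → Dec (OddResidue b k)
oddResidue? b k = (2 ∣? powerProduct b k) ×-dec ¬? (8 ∣? powerProduct b k)

oddResidue-three : ∀ {b} → b ∈ bases → OddResidue b 3
oddResidue-three = on-bases (λ b → oddResidue? b 3)

period-checks : ∀ {b} → b ∈ bases → ∀ {i} → i < 8 → 2 ∤ 5 + i →
                NonSquare 480 (powerProduct b (5 + i) % 480) × OddResidue b (5 + i)
period-checks = on-bases (λ b → allUpTo? (λ i →
  ¬? (2 ∣? 5 + i) →-dec (nonSquare? 480 (powerProduct b (5 + i) % 480) ×-dec oddResidue? b (5 + i))) 8)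

^∸1-period : ∀ {m} a i j → 1 ≤ a → m ∣ a ^ 5 * (a ^ 8 ∸ 1) →
             ∃ λ c → a ^ (5 + i + 8 * j) ∸ 1 ≡ (a ^ (5 + i) ∸ 1) + m * c
^∸1-period {m} a i j 1≤a m∣ with ∣-trans m∣ (*-monoʳ-∣ (a ^ 5) (^∸1-∣ a 8 j 1≤a))
... | divides c eq = c * a ^ i , (begin
  a ^ (5 + i + 8 * j) ∸ 1                     ≡⟨ cong (_∸ 1) (^-distribˡ-+-* a (5 + i) (8 * j)) ⟩
  a ^ (5 + i) * a ^ (8 * j) ∸ 1               ≡⟨ cong (λ u → a ^ (5 + i) * u ∸ 1) (suc-pred-^ a (8 * j) 1≤a) ⟨
  a ^ (5 + i) * suc d ∸ 1                     ≡⟨ cong (_∸ 1) (*-suc (a ^ (5 + i)) d) ⟩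
  a ^ (5 + i) + a ^ (5 + i) * d ∸ 1           ≡⟨ +-∸-comm (a ^ (5 + i) * d) (m^n>0 a {{>-nonZero 1≤a}} (5 + i)) ⟩
  (a ^ (5 + i) ∸ 1) + a ^ (5 + i) * d         ≡⟨ cong (λ u → (a ^ (5 + i) ∸ 1) + u * d) (^-distribˡ-+-* a 5 i) ⟩
  (a ^ (5 + i) ∸ 1) + a ^ 5 * a ^ i * d       ≡⟨ cong ((a ^ (5 + i) ∸ 1) +_) (regroup (a ^ 5) (a ^ i) d) ⟩
  (a ^ (5 + i) ∸ 1) + a ^ 5 * d * a ^ i       ≡⟨ cong (λ u → (a ^ (5 + i) ∸ 1) + u * a ^ i) eq ⟩
  (a ^ (5 + i) ∸ 1) + c * m * a ^ i           ≡⟨ cong ((a ^ (5 + i) ∸ 1) +_) (regroup′ c m (a ^ i)) ⟩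
  (a ^ (5 + i) ∸ 1) + m * (c * a ^ i)         ∎)
  where
  open ≡-Reasoning
  d = a ^ (8 * j) ∸ 1
  regroup : ∀ x y d → x * y * d ≡ x * d * y
  regroup = solve-∀
  regroup′ : ∀ c m y → c * m * y ≡ m * (c * y)
  regroup′ = solve-∀

powerProduct-period : ∀ {b} → b ∈ bases → ∀ i j →
  ∃ λ c → powerProduct b (5 + i + 8 * j) ≡ powerProduct b (5 + i) + c * 480
powerProduct-period {b} b∈ i j =
  let c , eq = ^∸1-period 2 i j (s≤s z≤n) (from-yes (480 ∣? 2 ^ 5 * (2 ^ 8 ∸ 1)))
      c′ , eq′ = ^∸1-period b i j (1≤base b∈) (480∣b^13∸b^5 b∈)
  in X * c′ + c * Y + 480 * c * c′ , trans (cong₂ _*_ eq eq′) (regroup 480 X Y c c′)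
  where
  X = 2 ^ (5 + i) ∸ 1
  Y = b ^ (5 + i) ∸ 1
  regroup : ∀ m x y c c′ → (x + m * c) * (y + m * c′) ≡ x * y + (x * c′ + c * y + m * c * c′) * m
  regroup = solve-∀

OddCase : ℕ → Set
OddCase N = (∀ y → N ≢ y * y) × 2 ∣ N × 8 ∤ N

oddCase-+ : ∀ {N} c → NonSquare 480 (N % 480) → 2 ∣ N → 8 ∤ N → OddCase (N + c * 480)
oddCase-+ {N} c nsq 2∣ 8∤ =
  nonSquare (subst (NonSquare 480) (sym ([m+kn]%n≡m%n N c 480)) nsq) ,
  ∣m∣n⇒∣m+n 2∣ (∣n⇒∣m*n c (from-yes (2 ∣? 480))) ,
  λ 8∣ → 8∤ (∣m+n∣m⇒∣n (subst (8 ∣_) (+-comm N (c * 480)) 8∣) (∣n⇒∣m*n c (from-yes (8 ∣? 480))))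

oddCase-≥5 : ∀ {b} → b ∈ bases → ∀ i j → i < 8 → 2 ∤ 5 + i → OddCase (powerProduct b (5 + i + 8 * j))
oddCase-≥5 b∈ i j i<8 2∤ =
  let c , eq = powerProduct-period b∈ i j
      nsq , 2∣ , 8∤ = period-checks b∈ i<8 2∤
  in subst OddCase (sym eq) (oddCase-+ c nsq 2∣ 8∤)

oddCase : ∀ {b} → b ∈ bases → ∀ k → 2 ≤ k → 2 ∤ k → OddCase (powerProduct b k)
oddCase b∈ 0 () 2∤k
oddCase b∈ 1 (s≤s ()) 2∤k
oddCase b∈ 2 2≤k 2∤k = contradiction ∣-refl 2∤k
-- The period modulo 480 starts only at exponent 5, so 3 is treated by itself.
oddCase {b} b∈ 3 2≤k 2∤k = non-square (small-exponents b∈ {1} (s≤s (s≤s z≤n))) , oddResidue-three b∈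
  where
  non-square : NonSquare 1408 (powerProduct b 3 % 1408) ⊎ b ≡ 7 × 1 ≡ 0 → ∀ y → powerProduct b 3 ≢ y * y
  non-square (inj₁ nsq) = nonSquare nsq
oddCase b∈ 4 2≤k 2∤k = contradiction (divides-refl 2) 2∤k
oddCase {b} b∈ (suc (suc (suc (suc (suc r))))) 2≤k 2∤k =
  subst (OddCase ∘ powerProduct b) (sym k≡) (oddCase-≥5 b∈ i j (m%n<n r 8) 2∤5+i)
  where
  i = r % 8
  j = r / 8
  k≡ : 5 + r ≡ 5 + i + 8 * j
  k≡ = cong (5 +_) (trans (m≡m%n+[m/n]*n r 8) (cong (i +_) (*-comm j 8)))
  2∤5+i : 2 ∤ 5 + i
  2∤5+i 2∣ = 2∤k (subst (2 ∣_) (sym k≡) (∣m∣n⇒∣m+n 2∣ (∣m⇒∣m*n j (divides-refl 4))))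

odd-exponent-impossible : ∀ {b p} → b ∈ bases → ∀ k y → 2 ≤ k → 2 ∤ k → Prime p → powerProduct b k ≢ y ^ p
odd-exponent-impossible {b} {0} b∈ k y 2≤k 2∤k pp eq = ¬prime[0] pp
odd-exponent-impossible {b} {1} b∈ k y 2≤k 2∤k pp eq = ¬prime[1] pp
odd-exponent-impossible {b} {2} b∈ k y 2≤k 2∤k pp eq =
  proj₁ (oddCase b∈ k 2≤k 2∤k) y (trans eq (cong (y *_) (*-identityʳ y)))
odd-exponent-impossible {b} {p@(suc (suc (suc e)))} b∈ k y 2≤k 2∤k pp eq =
  let _ , 2∣ , 8∤ = oddCase b∈ k 2≤k 2∤k
      2∣y = ∣^⇒∣ prime[2] y p (subst (2 ∣_) eq 2∣)
  in 8∤ (subst (8 ∣_) (sym eq) (∣-trans (∣⇒^∣^ 3 2∣y)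
       (subst (y ^ 3 ∣_) (sym (^-distribˡ-+-* y 3 e)) (m∣m*n (y ^ e)))))

-- Even exponents

-- Expanding `(A * B)^2` both as `(y + C)^2` and as `suc α * suc β` gives
-- `2 * (y * C) + C * C = α + β + 1`; adding `C * C + 1` to both sides yields the equation of a
-- triple.
square⇒Triple : ∀ {A B α β y} → A * A ≡ suc α → B * B ≡ suc β → α * β ≡ y * y →
                ∃ λ C → y + C ≡ A * B × 1 ≤ C × Triple A C B
square⇒Triple {A} {B} {α} {β} {y} A²≡ B²≡ αβ≡y² = C , y+C≡M , m<n⇒0<n∸m y<M , triple equation
  where
  open ≤-Reasoning
  M = A * B
  C = M ∸ y
  M²≡ : M * M ≡ suc α * suc β
  M²≡ = trans ([m*n]*[o*p]≡[m*o]*[n*p] A B A B) (cong₂ _*_ A²≡ B²≡)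
  expand : ∀ α β → suc α * suc β ≡ suc (α * β + (α + β))
  expand = solve-∀
  y<M : y < M
  y<M = ≰⇒> λ M≤y → <⇒≱ (begin-strict
    y * y                    ≡⟨ αβ≡y² ⟨
    α * β                    ≤⟨ m≤m+n (α * β) (α + β) ⟩
    α * β + (α + β)          <⟨ n<1+n _ ⟩
    suc (α * β + (α + β))    ≡⟨ expand α β ⟨
    suc α * suc β            ≡⟨ M²≡ ⟨
    M * M                    ∎) (*-mono-≤ M≤y M≤y)
  y+C≡M : y + C ≡ M
  y+C≡M = m+[n∸m]≡n (<⇒≤ y<M)
  2yC+C²≡ : 2 * (y * C) + C * C ≡ suc (α + β)
  2yC+C²≡ = +-cancelˡ-≡ (y * y) _ _ (begin-equality
    y * y + (2 * (y * C) + C * C)     ≡⟨ regroup y C ⟩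
    (y + C) * (y + C)                 ≡⟨ cong (λ u → u * u) y+C≡M ⟩
    M * M                             ≡⟨ trans M²≡ (expand α β) ⟩
    suc (α * β + (α + β))             ≡⟨ +-suc (α * β) (α + β) ⟨
    α * β + suc (α + β)               ≡⟨ cong (_+ suc (α + β)) αβ≡y² ⟩
    y * y + suc (α + β)               ∎)
    where
    regroup : ∀ y c → y * y + (2 * (y * c) + c * c) ≡ (y + c) * (y + c)
    regroup = solve-∀
  equation : A * A + C * C + B * B ≡ 1 + 2 * (A * C * B)
  equation = begin-equality
    A * A + C * C + B * B             ≡⟨ cong₂ (λ u v → u + C * C + v) A²≡ B²≡ ⟩
    suc α + C * C + suc β             ≡⟨ regroup α β C ⟩
    1 + (suc (α + β) + C * C)         ≡⟨ cong (λ u → 1 + (u + C * C)) 2yC+C²≡ ⟨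
    1 + (2 * (y * C) + C * C + C * C) ≡⟨ regroup′ y C ⟩
    1 + 2 * ((y + C) * C)             ≡⟨ cong (λ u → 1 + 2 * (u * C)) y+C≡M ⟩
    1 + 2 * (A * B * C)               ≡⟨ cong (λ u → 1 + 2 * u) (swap-last A B C) ⟩
    1 + 2 * (A * C * B)               ∎
    where
    regroup : ∀ α β c → suc α + c * c + suc β ≡ 1 + (suc (α + β) + c * c)
    regroup = solve-∀
    regroup′ : ∀ y c → 1 + (2 * (y * c) + c * c + c * c) ≡ 1 + 2 * ((y + c) * c)
    regroup′ = solve-∀
    swap-last : ∀ a b c → a * b * c ≡ a * c * b
    swap-last = solve-∀

^-square : ∀ a t → a ^ t * a ^ t ≡ a ^ (2 * t)
^-square a t = begin
  a ^ t * a ^ t       ≡⟨ ^-distribˡ-+-* a t t ⟨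
  a ^ (t + t)         ≡⟨ cong (λ u → a ^ (t + u)) (+-identityʳ t) ⟨
  a ^ (2 * t)         ∎
  where open ≡-Reasoning

square-exponent : ∀ {b} → b ∈ bases → ∀ t y → 1 ≤ t → powerProduct b (2 * t) ≡ y * y → 2 ^ (2 * t) ∣ 16 * t
square-exponent {b} b∈ t y 1≤t eq = 2^∣base^[2t]∸1 b∈ (2 * t) t 1≤t (subst (_∣ β) (^-square 2 t) A²∣β)
  where
  A = 2 ^ t
  B = b ^ t
  α = 2 ^ (2 * t) ∸ 1
  β = b ^ (2 * t) ∸ 1
  A²≡ : A * A ≡ suc α
  A²≡ = trans (^-square 2 t) (sym (suc-pred-^ 2 (2 * t) (s≤s z≤n)))
  B²≡ : B * B ≡ suc β
  B²≡ = trans (^-square b t) (sym (suc-pred-^ b (2 * t) (1≤base b∈)))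
  2∣β : 2 ∣ β
  2∣β = ∣-trans (∣-trans (divides-refl 2) (4∣base²∸1 b∈)) (^∸1-∣ b 2 t (1≤base b∈))
  2∣A : 2 ∣ A
  2∣A = subst (λ e → 2 ∣ 2 ^ e) (m+[n∸m]≡n 1≤t) (m∣m*n (2 ^ (t ∸ 1)))
  2∤B : 2 ∤ B
  2∤B 2∣B = ∤-suc prime[2] 2∣β (subst (2 ∣_) B²≡ (∣m⇒∣m*n B 2∣B))
  2∣y : 2 ∣ y
  2∣y = [ (λ d → d) , (λ d → d) ]′ (euclidsLemma y y prime[2] (subst (2 ∣_) eq (∣n⇒∣m*n α 2∣β)))
  A²∣β : A * A ∣ β
  A²∣β =
    let C , y+C≡ , 1≤C , tr = square⇒Triple {y = y} A²≡ B²≡ eq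
        2∣C = ∣m+n∣m⇒∣n (subst (2 ∣_) (sym y+C≡) (∣m⇒∣m*n B 2∣A)) 2∣y
        -- Equal valuations are used at `s = t`, where `2 ^ t` is `A` itself.
        A∣C = proj₁ (triple⇒SameTwoPower 2∣A 2∣C 2∤B (m^n>0 2 t) 1≤C tr t) ∣-refl
        sum≡ : A * A + C * C + β ≡ 2 * (A * C * B)
        sum≡ = suc-injective (trans (sym (+-suc (A * A + C * C) β))
          (trans (cong (A * A + C * C +_) (sym B²≡)) (Triple.equation tr)))
    -- `A * A` divides every term of the equation other than `β`, hence also `β`.
    in ∣m+n∣m⇒∣n (subst (A * A ∣_) (sym sum≡) (∣n⇒∣m*n 2 (∣m⇒∣m*n B (*-pres-∣ (∣-refl {A}) A∣C))))
         (∣m∣n⇒∣m+n (∣-refl {A * A}) (*-pres-∣ A∣C A∣C))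

16t<2^[2t] : ∀ e → 16 * (3 + e) < 2 ^ (2 * (3 + e))
16t<2^[2t] zero = from-yes (48 <? 64)
16t<2^[2t] (suc e) = begin-strict
  16 * (4 + e)                    ≤⟨ m≤m+n (16 * (4 + e)) (128 + 48 * e) ⟩
  16 * (4 + e) + (128 + 48 * e)   ≡⟨ regroup e ⟩
  4 * (16 * (3 + e))              <⟨ *-monoʳ-< 4 (16t<2^[2t] e) ⟩
  2 ^ 2 * 2 ^ (2 * (3 + e))       ≡⟨ ^-distribˡ-+-* 2 2 (2 * (3 + e)) ⟨
  2 ^ (2 + 2 * (3 + e))           ≡⟨ cong (2 ^_) (*-suc 2 (3 + e)) ⟨
  2 ^ (2 * (4 + e))               ∎
  where
  open ≤-Reasoning
  regroup : ∀ e → 16 * (4 + e) + (128 + 48 * e) ≡ 4 * (16 * (3 + e))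
  regroup = solve-∀

small-square : ∀ {b} → b ∈ bases → ∀ i y → i < 3 → powerProduct b (2 + i) ≡ y * y → b ≡ 7 × 2 + i ≡ 2
small-square {b} b∈ i y i<3 eq = decide (small-exponents b∈ i<3)
  where
  decide : NonSquare 1408 (powerProduct b (2 + i) % 1408) ⊎ b ≡ 7 × i ≡ 0 → b ≡ 7 × 2 + i ≡ 2
  decide (inj₁ nsq) = contradiction eq (nonSquare nsq y)
  decide (inj₂ (b≡7 , i≡0)) = b≡7 , cong (2 +_) i≡0

even-square : ∀ {b} → b ∈ bases → ∀ t y → 1 ≤ t → powerProduct b (2 * t) ≡ y * y → b ≡ 7 × 2 * t ≡ 2
even-square b∈ 1 y _ eq = small-square b∈ 0 y (s≤s z≤n) eq
even-square b∈ 2 y _ eq = small-square b∈ 2 y ≤-refl eq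
even-square b∈ (suc (suc (suc e))) y 1≤t eq =
  contradiction (∣⇒≤ (square-exponent b∈ (3 + e) y 1≤t eq)) (<⇒≱ (16t<2^[2t] e))

-- The square of `5 ^ s ≥ (5/4) 4 ^ s`. For bases `b ≥ 5` this yields the margin `B ≥ (5/4) A^2`
-- that `gap-three` requires.
25*16^s≤16*25^s : ∀ s → 1 ≤ s → 25 * 16 ^ s ≤ 16 * 25 ^ s
25*16^s≤16*25^s (suc e) _ = begin
  25 * (16 * 16 ^ e)    ≡⟨ regroup 25 16 (16 ^ e) ⟩
  16 * (25 * 16 ^ e)    ≤⟨ *-monoʳ-≤ 16 (*-monoʳ-≤ 25 (^-monoˡ-≤ e (≤ᵇ⇒≤ 16 25 _))) ⟩
  16 * (25 * 25 ^ e)    ∎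
  where
  open ≤-Reasoning
  regroup : ∀ k l y → k * (l * y) ≡ l * (k * y)
  regroup = solve-∀

multiple-exponent-impossible : ∀ {b} → b ∈ bases → ∀ s p y → 1 ≤ s → Prime p → 3 ≤ p →
                               powerProduct b (s * p) ≢ y ^ p
multiple-exponent-impossible {b} b∈ s p y 1≤s pp 3≤p = impossible p pp 3≤p
  where
  A = 2 ^ s
  B = b ^ s
  5≤b = proj₁ (base-bounds b∈)
  pow≡ : ∀ a p → 1 ≤ a → (a ^ s) ^ p ≡ suc (a ^ (s * p) ∸ 1)
  pow≡ a p 1≤a = trans (^-*-assoc a s p) (sym (suc-pred-^ a (s * p) 1≤a))
  A^≡ : ∀ p → A ^ p ≡ suc (2 ^ (s * p) ∸ 1)
  A^≡ p = pow≡ 2 p (s≤s z≤n)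
  B^≡ : ∀ p → B ^ p ≡ suc (b ^ (s * p) ∸ 1)
  B^≡ p = pow≡ b p (1≤base b∈)
  2≤A : 2 ≤ A
  2≤A = ^-monoʳ-≤ 2 1≤s
  1≤B : 1 ≤ B
  1≤B = m^n>0 b {{>-nonZero (1≤base b∈)}} s
  A^j≡ : ∀ j → A ^ j ≡ (2 ^ j) ^ s
  A^j≡ j = trans (^-*-assoc 2 s j) (trans (cong (2 ^_) (*-comm s j)) (sym (^-*-assoc 2 j s)))
  B≤A^5 : B ≤ A ^ 5
  B≤A^5 = subst (B ≤_) (sym (A^j≡ 5)) (^-monoˡ-≤ s (≤-trans (proj₂ (base-bounds b∈)) (≤ᵇ⇒≤ 29 32 _)))
  A²≤B : A * A ≤ B
  A²≤B = begin
    A * A        ≡⟨ *-^-distrib 2 2 s ⟨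
    4 ^ s        ≤⟨ ^-monoˡ-≤ s (≤-trans (n≤1+n 4) 5≤b) ⟩
    B            ∎
    where open ≤-Reasoning
  25A^4≤16B² : 25 * A ^ 4 ≤ 16 * (B * B)
  25A^4≤16B² = begin
    25 * A ^ 4        ≡⟨ cong (25 *_) (A^j≡ 4) ⟩
    25 * 16 ^ s       ≤⟨ 25*16^s≤16*25^s s 1≤s ⟩
    16 * 25 ^ s       ≤⟨ *-monoʳ-≤ 16 (^-monoˡ-≤ s (*-mono-≤ 5≤b 5≤b)) ⟩
    16 * (b * b) ^ s  ≡⟨ cong (16 *_) (*-^-distrib b b s) ⟩
    16 * (B * B)      ∎
    where open ≤-Reasoning
  impossible : ∀ p → Prime p → 3 ≤ p → powerProduct b (s * p) ≢ y ^ p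
  impossible 1 _ (s≤s ())
  impossible 2 _ (s≤s (s≤s ()))
  impossible 3 _ _ = gap-three {x = y} 2≤A 1≤B 25A^4≤16B² B≤A^5 (A^≡ 3) (B^≡ 3)
  impossible 4 p4 _ = contradiction p4 (composite⇒¬prime composite[4])
  impossible 5 _ _ = gap-five {x = y} 2≤A A²≤B B≤A^5 (A^≡ 5) (B^≡ 5)
  impossible 6 p6 _ = contradiction p6 (composite⇒¬prime composite[6])
  impossible p@(suc (suc (suc (suc (suc (suc (suc e))))))) _ _ =
    gap-large p {x = y} (m≤m+n 7 e) 2≤A 1≤B (≤-trans (m≤m*n A A {{m^n≢0 2 s}}) A²≤B) B≤A^5 (A^≡ p) (B^≡ p)

even-exponent : ∀ {b p} → b ∈ bases → ∀ t y → 1 ≤ t → Prime p →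
                powerProduct b (2 * t) ≡ y ^ p → b ≡ 7 × 2 * t ≡ 2
even-exponent {b} {0} b∈ t y 1≤t pp eq = contradiction pp ¬prime[0]
even-exponent {b} {1} b∈ t y 1≤t pp eq = contradiction pp ¬prime[1]
even-exponent {b} {2} b∈ t y 1≤t pp eq = even-square b∈ t y 1≤t (trans eq (cong (y *_) (*-identityʳ y)))
even-exponent {b} {p@(suc (suc (suc e)))} b∈ t y 1≤t pp eq =
  contradiction (subst (λ k → powerProduct b k ≡ y ^ p) k≡sp eq)
    (multiple-exponent-impossible b∈ (quotient p∣k) p y 1≤s pp 3≤p)
  where
  3≤p : 3 ≤ p
  3≤p = m≤m+n 3 e
  1≤k : 1 ≤ 2 * t
  1≤k = *-mono-≤ {1} {2} (s≤s z≤n) 1≤t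
  p∣k : p ∣ 2 * t
  p∣k = Exponent.∣k {y = y} b∈ pp 3≤p 1≤k (m∣m*n t) eq p (s≤s z≤n) ≤-refl
  k≡sp : 2 * t ≡ quotient p∣k * p
  k≡sp = m∣n⇒n≡quotient*m p∣k
  1≤s : 1 ≤ quotient p∣k
  1≤s = >-nonZero⁻¹ _ {{m*n≢0⇒m≢0 (quotient p∣k) {{>-nonZero (subst (1 ≤_) k≡sp 1≤k)}}}}

-- Both parities combined, and the powers equal to 144

perfect-power : ∀ {b p} → b ∈ bases → ∀ k y → 2 ≤ k → Prime p → powerProduct b k ≡ y ^ p → b ≡ 7 × k ≡ 2
perfect-power {b} {p} b∈ k y 2≤k pp eq with 2 ∣? k
... | no 2∤k = contradiction eq (odd-exponent-impossible b∈ k y 2≤k 2∤k pp)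
... | yes (divides t k≡t2) =
  let b≡7 , 2t≡2 = even-exponent b∈ t y 1≤t pp (subst (λ k → powerProduct b k ≡ y ^ p) k≡2t eq)
  in b≡7 , trans k≡2t 2t≡2
  where
  k≡2t : k ≡ 2 * t
  k≡2t = trans k≡t2 (*-comm t 2)
  1≤t : 1 ≤ t
  1≤t = >-nonZero⁻¹ t {{m*n≢0⇒m≢0 t {{>-nonZero (subst (1 ≤_) k≡t2 (≤-trans (s≤s z≤n) 2≤k))}}}}

-- The search bounds come from `2 ^ 8 > 144` and `x ≤ x ^ n`.
144-powers : ∀ {n} → n < 8 → ∀ {x} → x < 145 → 2 ≤ n → x ^ n ≡ 144 → x ≡ 12 × n ≡ 2
144-powers = from-yes (allUpTo? (λ n → allUpTo? (λ x →
  2 ≤? n →-dec (x ^ n ≟ 144 →-dec (x ≟ 12 ×-dec n ≟ 2))) 145) 8)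

144-power : ∀ n x → 2 ≤ n → x ^ n ≡ 144 → x ≡ 12 × n ≡ 2
144-power n x 2≤n eq = 144-powers n<8 x<145 2≤n eq
  where
  open ≤-Reasoning
  2≤x : 2 ≤ x
  2≤x = ≰⇒> λ x≤1 → <⇒≱ {1} {144} (s≤s (s≤s z≤n)) (begin
    144       ≡⟨ eq ⟨
    x ^ n     ≤⟨ ^-monoˡ-≤ n x≤1 ⟩
    1 ^ n     ≡⟨ ^-zeroˡ n ⟩
    1         ∎)
  n<8 : n < 8
  n<8 = ≰⇒> λ 8≤n → <⇒≱ (<ᵇ⇒< 144 256 _) (begin
    2 ^ 8     ≤⟨ ^-monoʳ-≤ 2 8≤n ⟩
    2 ^ n     ≤⟨ ^-monoˡ-≤ n 2≤x ⟩
    x ^ n     ≡⟨ eq ⟩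
    144       ∎)
  x<145 : x < 145
  x<145 = s≤s (begin
    x         ≡⟨ *-identityʳ x ⟨
    x ^ 1     ≤⟨ ^-monoʳ-≤ x {{>-nonZero (≤-trans (s≤s z≤n) 2≤x)}} (≤-trans (s≤s z≤n) 2≤n) ⟩
    x ^ n     ≡⟨ eq ⟩
    144       ∎)

theorem4 : ∀ (b k x n : ℕ) →
    b ∈ 5 ∷ 7 ∷ 11 ∷ 13 ∷ 21 ∷ 23 ∷ 27 ∷ 29 ∷ [] →
    2 ≤ k → 1 ≤ x → 2 ≤ n →
    ((2 ^ k ∸ 1) * (b ^ k ∸ 1) ≡ x ^ n) ⇔
    (b ≡ 7 × k ≡ 2 × x ≡ 12 × n ≡ 2)
theorem4 b k x n b∈ 2≤k 1≤x 2≤n = mk⇔ to λ { (refl , refl , refl , refl) → refl }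
  where
  to : (2 ^ k ∸ 1) * (b ^ k ∸ 1) ≡ x ^ n → b ≡ 7 × k ≡ 2 × x ≡ 12 × n ≡ 2
  to eq =
    let p , pp , divides m n≡mp = prime-factor n 2≤n
        b≡7 , k≡2 = perfect-power b∈ k (x ^ m) 2≤k pp
                      (trans eq (trans (cong (x ^_) n≡mp) (sym (^-*-assoc x m p))))
    -- At `b = 7` and `k = 2` the left-hand side evaluates to 3 · 48 = 144.
    in b≡7 , k≡2 , 144-power n x 2≤n
         (trans (sym eq) (cong₂ (λ b k → (2 ^ k ∸ 1) * (b ^ k ∸ 1)) b≡7 k≡2))
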